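{- Let $(\mathcal{E},\mathcal{S})$ be a predicative category with small maps and $\mathcal{C}$ an internal category in $\mathcal{E}$ whose codomain map $\mathrm{cod}:\mathcal{C}_1\to\mathcal{C}_0$ is small. Then the category $\mathrm{Psh}_{\mathcal{E}}(\mathcal{C})$ of internal presheaves, together with the class of pointwise small maps, is a category with small maps (that is, $\mathrm{Psh}_{\mathcal{E}}(\mathcal{C})$ is a positive Heyting category and the pointwise small maps satisfy axioms (A1)–(A9)).
   Context: A positive Heyting category has finite limits, stable cover/mono factorisations, disjoint stable finite coproducts, and right adjoints $\forall_f$ to pullback of subobjects. A class of small maps $\mathcal{S}$ satisfies: (A1) pullback stability; (A2) descent: if the pullback of $f$ along a cover is small then $f$ is small; (A3) closure under $X+X'\to Y+Y'$; (A4) $0\to1,1\to1,1+1\to1$ small; (A5) closure under composition; (A6) if $g\circ f$ small with $f$ a cover then $g$ small; (A7) collection: for a cover $p:Y\to X$ and small $f:X\to A$ there is a commuting square with small left side $g:Z\to B$, top $Z\to Y\xrightarrow{p}X$, right side $f$, bottom a cover $B\to A$, such that $Z\to B\times_AX$ is a cover; (A8) for small $f$, $\forall_f$ maps subobjects given by small monos to such; (A9) diagonals are small. $(\mathcal{E},\mathcal{S})$ is a predicative category with small maps if moreover small maps are exponentiable, W-types of small maps exist, there is a natural numbers object $\mathbb{N}$ with $\mathbb{N}\to1$ small, there is a universal small map, and equivalence relations given by small monos have stable quotients. An internal presheaf on $\mathcal{C}$ is an object $P\to\mathcal{C}_0$ of $\mathcal{E}/\mathcal{C}_0$ (fibres $P(a)$)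 with a right action by arrows of $\mathcal{C}$ ($x\in P(a)$, $f:b\to a$ give $x\cdot f\in P(b)$) satisfying the usual identity and composition laws. A morphism $F$ of internal presheaves is pointwise small if its underlying morphism in $\mathcal{E}/\mathcal{C}_0$ (the forgetful image $\pi^*F$) belongs to $\mathcal{S}$. -}

module Defs where

open import Level using (Level; _⊔_; suc)
open import Data.Product using (∃; _×_)
open import Function.Bundles using (_⇔_)
open import Relation.Binary.Core using (Rel)
open import Relation.Binary.Bundles using (Setoid)
open import Relation.Binary.Structures using (IsEquivalence)
import Relation.Binary.Reasoning.Setoid as SetoidReasoning

record Category (o ℓ e : Level) : Set (suc (o ⊔ ℓ ⊔ e)) where
  infix  4 _≈_ _⇒_
  infixr 9 _∘_
  field
    Obj : Set o
    _⇒_ : Obj → Obj → Set ℓ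
    _≈_ : ∀ {A B} → Rel (A ⇒ B) e
    id  : ∀ {A} → A ⇒ A
    _∘_ : ∀ {A B C} → B ⇒ C → A ⇒ B → A ⇒ C

    assoc     : ∀ {A B C D} {f : A ⇒ B} {g : B ⇒ C} {h : C ⇒ D} → (h ∘ g) ∘ f ≈ h ∘ (g ∘ f)
    identityˡ : ∀ {A B} {f : A ⇒ B} → id ∘ f ≈ f
    identityʳ : ∀ {A B} {f : A ⇒ B} → f ∘ id ≈ f
    equiv     : ∀ {A B} → IsEquivalence (_≈_ {A} {B})
    ∘-resp-≈  : ∀ {A B C} {f h : B ⇒ C} {g i : A ⇒ B} → f ≈ h → g ≈ i → f ∘ g ≈ h ∘ i

  hom-setoid : ∀ {A B} → Setoid ℓ e
  hom-setoid {A} {B} = record { Carrier = A ⇒ B ; _≈_ = _≈_ ; isEquivalence = equiv }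

  module Equiv {A B : Obj} = IsEquivalence (equiv {A} {B})
  module HomReasoning {A B : Obj} = SetoidReasoning (hom-setoid {A} {B})

  ∘-resp-≈ˡ : ∀ {A B C} {f h : B ⇒ C} {g : A ⇒ B} → f ≈ h → f ∘ g ≈ h ∘ g
  ∘-resp-≈ˡ p = ∘-resp-≈ p Equiv.refl

  ∘-resp-≈ʳ : ∀ {A B C} {f : B ⇒ C} {g i : A ⇒ B} → g ≈ i → f ∘ g ≈ f ∘ i
  ∘-resp-≈ʳ p = ∘-resp-≈ Equiv.refl p

module _ {o ℓ e} (𝒞 : Category o ℓ e) where
  open Category 𝒞

  Mono : ∀ {A B} → A ⇒ B → Set (o ⊔ ℓ ⊔ e)
  Mono {A} f = ∀ {Z} (g h : Z ⇒ A) → f ∘ g ≈ f ∘ h → g ≈ h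

  record IsIso {A B} (f : A ⇒ B) : Set (ℓ ⊔ e) where
    field
      inv  : B ⇒ A
      isoˡ : inv ∘ f ≈ id
      isoʳ : f ∘ inv ≈ id

  -- A cover factors through no proper subobject of its codomain.
  Cover : ∀ {A B} → A ⇒ B → Set (o ⊔ ℓ ⊔ e)
  Cover {A} {B} f = ∀ {M} (m : M ⇒ B) (g : A ⇒ M) → Mono m → m ∘ g ≈ f → IsIso m

  record IsTerminal (T : Obj) : Set (o ⊔ ℓ ⊔ e) where
    field
      !        : ∀ {A} → A ⇒ T
      !-unique : ∀ {A} (f : A ⇒ T) → f ≈ !

  record IsInitial (I : Obj) : Set (o ⊔ ℓ ⊔ e) where
    field
      ¡        : ∀ {A} → I ⇒ A
      ¡-unique : ∀ {A} (f : I ⇒ A) → f ≈ ¡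

  record IsProduct {P A B} (π₁ : P ⇒ A) (π₂ : P ⇒ B) : Set (o ⊔ ℓ ⊔ e) where
    field
      ⟨_,_⟩    : ∀ {Q} → Q ⇒ A → Q ⇒ B → Q ⇒ P
      project₁ : ∀ {Q} {h : Q ⇒ A} {k : Q ⇒ B} → π₁ ∘ ⟨ h , k ⟩ ≈ h
      project₂ : ∀ {Q} {h : Q ⇒ A} {k : Q ⇒ B} → π₂ ∘ ⟨ h , k ⟩ ≈ k
      unique   : ∀ {Q} {h : Q ⇒ A} {k : Q ⇒ B} {u : Q ⇒ P} →
                 π₁ ∘ u ≈ h → π₂ ∘ u ≈ k → u ≈ ⟨ h , k ⟩

  record Product (A B : Obj) : Set (o ⊔ ℓ ⊔ e) where
    field
      A×B       : Obj
      π₁        : A×B ⇒ A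
      π₂        : A×B ⇒ B
      isProduct : IsProduct π₁ π₂
    open IsProduct isProduct public

  record IsCoproduct {A B S} (i₁ : A ⇒ S) (i₂ : B ⇒ S) : Set (o ⊔ ℓ ⊔ e) where
    field
      [_,_]   : ∀ {Q} → A ⇒ Q → B ⇒ Q → S ⇒ Q
      inject₁ : ∀ {Q} {h : A ⇒ Q} {k : B ⇒ Q} → [ h , k ] ∘ i₁ ≈ h
      inject₂ : ∀ {Q} {h : A ⇒ Q} {k : B ⇒ Q} → [ h , k ] ∘ i₂ ≈ k
      unique  : ∀ {Q} {h : A ⇒ Q} {k : B ⇒ Q} {u : S ⇒ Q} →
                u ∘ i₁ ≈ h → u ∘ i₂ ≈ k → u ≈ [ h , k ]

  record Coproduct (A B : Obj) : Set (o ⊔ ℓ ⊔ e) where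
    field
      A+B         : Obj
      i₁          : A ⇒ A+B
      i₂          : B ⇒ A+B
      isCoproduct : IsCoproduct i₁ i₂
    open IsCoproduct isCoproduct public

  --        p₂
  --     P ----> B
  --  p₁ |       | g
  --     v       v
  --     A ----> C
  --         f
  record IsPullback {P A B C} (p₁ : P ⇒ A) (p₂ : P ⇒ B) (f : A ⇒ C) (g : B ⇒ C)
                    : Set (o ⊔ ℓ ⊔ e) where
    field
      commute      : f ∘ p₁ ≈ g ∘ p₂
      universal    : ∀ {Q} {h : Q ⇒ A} {k : Q ⇒ B} → f ∘ h ≈ g ∘ k → Q ⇒ P
      p₁∘universal : ∀ {Q} {h : Q ⇒ A} {k : Q ⇒ B} {eq : f ∘ h ≈ g ∘ k} → p₁ ∘ universal eq ≈ h
      p₂∘universal : ∀ {Q} {h : Q ⇒ A} {k : Q ⇒ B} {eq : f ∘ h ≈ g ∘ k} → p₂ ∘ universal eq ≈ k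
      unique       : ∀ {Q} {h : Q ⇒ A} {k : Q ⇒ B} {eq : f ∘ h ≈ g ∘ k} {u : Q ⇒ P} →
                     p₁ ∘ u ≈ h → p₂ ∘ u ≈ k → u ≈ universal eq

  record Pullback {A B C} (f : A ⇒ C) (g : B ⇒ C) : Set (o ⊔ ℓ ⊔ e) where
    field
      P          : Obj
      p₁         : P ⇒ A
      p₂         : P ⇒ B
      isPullback : IsPullback p₁ p₂ f g
    open IsPullback isPullback public

  record IsCoequalizer {A B Q} (f g : A ⇒ B) (q : B ⇒ Q) : Set (o ⊔ ℓ ⊔ e) where
    field
      equality   : q ∘ f ≈ q ∘ g
      coequalize : ∀ {Z} {h : B ⇒ Z} → h ∘ f ≈ h ∘ g → Q ⇒ Z
      factors    : ∀ {Z} {h : B ⇒ Z} {eq : h ∘ f ≈ h ∘ g} → coequalize eq ∘ q ≈ h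
      unique     : ∀ {Z} {h : B ⇒ Z} {eq : h ∘ f ≈ h ∘ g} {u : Q ⇒ Z} → u ∘ q ≈ h → u ≈ coequalize eq

  record Factorisation {A B} (f : A ⇒ B) : Set (o ⊔ ℓ ⊔ e) where
    field
      image     : Obj
      cover     : A ⇒ image
      mono      : image ⇒ B
      isCover   : Cover cover
      isMono    : Mono mono
      factorise : mono ∘ cover ≈ f

  record Subobject (X : Obj) : Set (o ⊔ ℓ ⊔ e) where
    field
      domain  : Obj
      arrow   : domain ⇒ X
      isMono  : Mono arrow

  infix 4 _⊑_
  _⊑_ : ∀ {X} → Rel (Subobject X) (ℓ ⊔ e)
  M ⊑ N = ∃ λ h → Subobject.arrow N ∘ h ≈ Subobject.arrow M

  record FiniteLimits : Set (o ⊔ ℓ ⊔ e) where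
    field
      ⊤          : Obj
      isTerminal : IsTerminal ⊤
      pullback   : ∀ {A B C} (f : A ⇒ C) (g : B ⇒ C) → Pullback f g
    open IsTerminal isTerminal public

    product : ∀ A B → Product A B
    product A B = record
      { A×B = P ; π₁ = p₁ ; π₂ = p₂
      ; isProduct = record
        { ⟨_,_⟩    = λ h k → universal {h = h} {k = k} (Equiv.trans (!-unique _) (Equiv.sym (!-unique _)))
        ; project₁ = p₁∘universal
        ; project₂ = p₂∘universal
        ; unique   = unique
        }
      }
      where open Pullback (pullback (! {A}) (! {B}))

    diagonal : ∀ X → X ⇒ Product.A×B (product X X)
    diagonal X = Product.⟨_,_⟩ (product X X) id id

    _⁻¹[_] : ∀ {X Y} → Y ⇒ X → Subobject X → Subobject Y
    f ⁻¹[ N ] = record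
      { domain = P
      ; arrow  = p₁
      ; isMono = λ g h eq → Equiv.trans
          (unique {eq = square h} eq
             (N.isMono (p₂ ∘ g) (p₂ ∘ h) (begin
               N.arrow ∘ (p₂ ∘ g)   ≈⟨ assoc ⟨
               (N.arrow ∘ p₂) ∘ g   ≈⟨ ∘-resp-≈ˡ commute ⟨
               (f ∘ p₁) ∘ g         ≈⟨ assoc ⟩
               f ∘ (p₁ ∘ g)         ≈⟨ ∘-resp-≈ʳ eq ⟩
               f ∘ (p₁ ∘ h)         ≈⟨ square h ⟩
               N.arrow ∘ (p₂ ∘ h)   ∎)))
          (Equiv.sym (unique Equiv.refl Equiv.refl))
      }
      where
      module N = Subobject N
      open Pullback (pullback f N.arrow)
      open HomReasoning
      square : ∀ {Z} (h : Z ⇒ P) → f ∘ (p₁ ∘ h) ≈ N.arrow ∘ (p₂ ∘ h)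
      square h = begin
        f ∘ (p₁ ∘ h)         ≈⟨ assoc ⟨
        (f ∘ p₁) ∘ h         ≈⟨ ∘-resp-≈ˡ commute ⟩
        (N.arrow ∘ p₂) ∘ h   ≈⟨ assoc ⟩
        N.arrow ∘ (p₂ ∘ h)   ∎

  record PositiveHeyting : Set (o ⊔ ℓ ⊔ e) where
    field
      finiteLimits : FiniteLimits
    open FiniteLimits finiteLimits public
    field
      factorisation : ∀ {A B} (f : A ⇒ B) → Factorisation f
      cover-stable  : ∀ {P A B C} {p₁ : P ⇒ A} {p₂ : P ⇒ B} {f : A ⇒ C} {g : B ⇒ C} →
                      IsPullback p₁ p₂ f g → Cover f → Cover p₂

      ⊥         : Obj
      isInitial : IsInitial ⊥
      coproduct : ∀ A B → Coproduct A B

    open IsInitial isInitial public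
    module Coprod A B = Coproduct (coproduct A B)

    infixr 6 _⊕_
    _⊕_ : Obj → Obj → Obj
    A ⊕ B = Coprod.A+B A B

    field
      i₁-mono  : ∀ {A B} → Mono (Coprod.i₁ A B)
      i₂-mono  : ∀ {A B} → Mono (Coprod.i₂ A B)
      disjoint : ∀ {A B P} {p₁ : P ⇒ A} {p₂ : P ⇒ B} →
                 IsPullback p₁ p₂ (Coprod.i₁ A B) (Coprod.i₂ A B) → IsInitial P
      ⊥-stable : ∀ {X} → X ⇒ ⊥ → IsInitial X
      ⊕-stable : ∀ {A B X X₁ X₂} {h : X ⇒ A ⊕ B}
                 {p₁ : X₁ ⇒ A} {j₁ : X₁ ⇒ X} {p₂ : X₂ ⇒ B} {j₂ : X₂ ⇒ X} →
                 IsPullback p₁ j₁ (Coprod.i₁ A B) h →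
                 IsPullback p₂ j₂ (Coprod.i₂ A B) h →
                 IsCoproduct j₁ j₂

      ∀[_]      : ∀ {X Y} → Y ⇒ X → Subobject Y → Subobject X
      ∀-adjoint : ∀ {X Y} (f : Y ⇒ X) (M : Subobject Y) (N : Subobject X) →
                  (f ⁻¹[ N ] ⊑ M) ⇔ (N ⊑ ∀[ f ] M)

module _ {o ℓ e} (𝒞 : Category o ℓ e) where
  open Category 𝒞

  record SliceObj (A : Obj) : Set (o ⊔ ℓ) where
    constructor sliceobj
    field
      {carrier} : Obj
      arr       : carrier ⇒ A

  record SliceHom {A : Obj} (X Y : SliceObj A) : Set (ℓ ⊔ e) where
    constructor slicehom
    private
      module X = SliceObj X
      module Y = SliceObj Y
    field
      {h} : X.carrier ⇒ Y.carrier
      △   : Y.arr ∘ h ≈ X.arr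

  Slice : Obj → Category (o ⊔ ℓ) (ℓ ⊔ e) e
  Slice A = record
    { Obj = SliceObj A
    ; _⇒_ = SliceHom
    ; _≈_ = λ f g → SliceHom.h f ≈ SliceHom.h g
    ; id  = slicehom identityʳ
    ; _∘_ = λ g f → slicehom (Equiv.trans (Equiv.sym assoc)
                      (Equiv.trans (∘-resp-≈ˡ (SliceHom.△ g)) (SliceHom.△ f)))
    ; assoc     = assoc
    ; identityˡ = identityˡ
    ; identityʳ = identityʳ
    ; equiv     = record { refl = Equiv.refl ; sym = Equiv.sym ; trans = Equiv.trans }
    ; ∘-resp-≈  = ∘-resp-≈
    }

  sliceProduct : FiniteLimits 𝒞 → ∀ {A} (X Y : SliceObj A) → Product (Slice A) X Y
  sliceProduct lim (sliceobj x) (sliceobj y) = record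
    { A×B = sliceobj (x ∘ p₁)
    ; π₁  = slicehom Equiv.refl
    ; π₂  = slicehom (Equiv.sym commute)
    ; isProduct = record
      { ⟨_,_⟩    = λ h k → slicehom
          {h = universal (Equiv.trans (SliceHom.△ h) (Equiv.sym (SliceHom.△ k)))}
          (Equiv.trans assoc (Equiv.trans (∘-resp-≈ʳ p₁∘universal) (SliceHom.△ h)))
      ; project₁ = p₁∘universal
      ; project₂ = p₂∘universal
      ; unique   = unique
      }
    }
    where open Pullback (FiniteLimits.pullback lim x y)

module _ {o ℓ e} (𝒞 : Category o ℓ e) (product : ∀ A B → Product 𝒞 A B) where
  open Category 𝒞

  private module Prod A B = Product (product A B)

  record Exponential (B C : Obj) : Set (o ⊔ ℓ ⊔ e) where
    field
      C^B    : Obj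
      eval   : Prod.A×B C^B B ⇒ C
      curry  : ∀ {X} → Prod.A×B X B ⇒ C → X ⇒ C^B
      β      : ∀ {X} {g : Prod.A×B X B ⇒ C} →
               eval ∘ Prod.⟨_,_⟩ C^B B (curry g ∘ Prod.π₁ X B) (Prod.π₂ X B) ≈ g
      unique : ∀ {X} {g : Prod.A×B X B ⇒ C} {u : X ⇒ C^B} →
               eval ∘ Prod.⟨_,_⟩ C^B B (u ∘ Prod.π₁ X B) (Prod.π₂ X B) ≈ g → u ≈ curry g

  ExponentiableObj : Obj → Set (o ⊔ ℓ ⊔ e)
  ExponentiableObj B = ∀ C → Exponential B C

module _ {o ℓ e} (𝒞 : Category o ℓ e) (lim : FiniteLimits 𝒞) where
  open Category 𝒞
  open FiniteLimits lim

  ExponentiableMap : ∀ {B A} → B ⇒ A → Set (o ⊔ ℓ ⊔ e)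
  ExponentiableMap {A = A} f = ExponentiableObj (Slice 𝒞 A) (sliceProduct 𝒞 lim) (sliceobj f)

  -- P_f(X) = Σ_{a ∈ A} X^{B_a} is the domain of the exponential, in the slice
  -- over A, of A × X → A by f : B → A.
  module Polynomial {B A} (f : B ⇒ A) (exp : ExponentiableMap f) where
    private module Prod Y Z = Product (product Y Z)

    A* : Obj → SliceObj 𝒞 A
    A* X = sliceobj (Prod.π₁ A X)

    A*₁ : ∀ {X Y} → X ⇒ Y → SliceHom 𝒞 (A* X) (A* Y)
    A*₁ {X} {Y} k = slicehom {h = Prod.⟨_,_⟩ A Y (Prod.π₁ A X) (k ∘ Prod.π₂ A X)} (Prod.project₁ A Y)

    private module Exp X = Exponential (exp (A* X))

    P₀ : Obj → Obj
    P₀ X = SliceObj.carrier (Exp.C^B X)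

    P₁ : ∀ {X Y} → X ⇒ Y → P₀ X ⇒ P₀ Y
    P₁ {X} {Y} k = SliceHom.h (Exp.curry Y (Category._∘_ (Slice 𝒞 A) (A*₁ k) (Exp.eval X)))

    record WType : Set (o ⊔ ℓ ⊔ e) where
      field
        W          : Obj
        sup        : P₀ W ⇒ W
        rec        : ∀ {X} → P₀ X ⇒ X → W ⇒ X
        rec-hom    : ∀ {X} {α : P₀ X ⇒ X} → rec α ∘ sup ≈ α ∘ P₁ (rec α)
        rec-unique : ∀ {X} {α : P₀ X ⇒ X} {k : W ⇒ X} → k ∘ sup ≈ α ∘ P₁ k → k ≈ rec α

  record NaturalNumbersObject : Set (o ⊔ ℓ ⊔ e) where
    field
      N          : Obj
      z          : ⊤ ⇒ N
      s          : N ⇒ N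
      rec        : ∀ {X} → ⊤ ⇒ X → X ⇒ X → N ⇒ X
      rec-z      : ∀ {X} {x : ⊤ ⇒ X} {t : X ⇒ X} → rec x t ∘ z ≈ x
      rec-s      : ∀ {X} {x : ⊤ ⇒ X} {t : X ⇒ X} → rec x t ∘ s ≈ t ∘ rec x t
      rec-unique : ∀ {X} {x : ⊤ ⇒ X} {t : X ⇒ X} {k : N ⇒ X} →
                   k ∘ z ≈ x → k ∘ s ≈ t ∘ k → k ≈ rec x t

  -- r₁, r₂ present an equivalence relation when the relation they induce on
  -- generalised elements of X at every stage T is one.
  record IsEquivalenceRelation {R X} (r₁ r₂ : R ⇒ X) : Set (o ⊔ ℓ ⊔ e) where
    field
      jointly-mono  : Mono 𝒞 (Product.⟨_,_⟩ (product X X) r₁ r₂)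
      isEquivalence : ∀ {T} → IsEquivalence {A = T ⇒ X} (λ x y → ∃ λ k → (r₁ ∘ k ≈ x) × (r₂ ∘ k ≈ y))

  record IsExact {R X Q} (r₁ r₂ : R ⇒ X) (q : X ⇒ Q) : Set (o ⊔ ℓ ⊔ e) where
    field
      isCoequalizer : IsCoequalizer 𝒞 r₁ r₂ q
      isKernelPair  : IsPullback 𝒞 r₁ r₂ q q

  module PulledBackFork {R X Q Q′} (r₁ r₂ : R ⇒ X) (q : X ⇒ Q) (fork : q ∘ r₁ ≈ q ∘ r₂) (p : Q′ ⇒ Q) where
    private
      module X′ = Pullback (pullback q p)
      module R′ = Pullback (pullback (q ∘ r₁) p)

    q′ : X′.P ⇒ Q′
    q′ = X′.p₂

    r₁′ r₂′ : R′.P ⇒ X′.P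
    r₁′ = X′.universal {h = r₁ ∘ R′.p₁} {k = R′.p₂} (Equiv.trans (Equiv.sym assoc) R′.commute)
    r₂′ = X′.universal {h = r₂ ∘ R′.p₁} {k = R′.p₂}
            (Equiv.trans (Equiv.sym assoc) (Equiv.trans (∘-resp-≈ˡ (Equiv.sym fork)) R′.commute))

  record StableQuotient {R X} (r₁ r₂ : R ⇒ X) : Set (o ⊔ ℓ ⊔ e) where
    field
      Q       : Obj
      q       : X ⇒ Q
      isExact : IsExact r₁ r₂ q
    open IsExact isExact public
    open IsCoequalizer isCoequalizer using (equality)
    field
      stable : ∀ {Q′} (p : Q′ ⇒ Q) → let open PulledBackFork r₁ r₂ q equality p in IsExact r₁′ r₂′ q′

record MapClass {o ℓ e} (𝒞 : Category o ℓ e) (s : Level) : Set (o ⊔ ℓ ⊔ e ⊔ suc s) where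
  open Category 𝒞
  field
    Small  : ∀ {A B} → A ⇒ B → Set s
    resp-≈ : ∀ {A B} {f g : A ⇒ B} → f ≈ g → Small f → Small g

module _ {o ℓ e s} (𝒞 : Category o ℓ e) (𝒮 : MapClass 𝒞 s) where
  open Category 𝒞
  open MapClass 𝒮

  record Collection (lim : FiniteLimits 𝒞) {Y X A} (p : Y ⇒ X) (f : X ⇒ A) : Set (o ⊔ ℓ ⊔ e ⊔ s) where
    open FiniteLimits lim
    field
      {Z B}   : Obj
      g       : Z ⇒ B
      t       : Z ⇒ Y
      b       : B ⇒ A
      g-small : Small g
      b-cover : Cover 𝒞 b
      commute : b ∘ g ≈ f ∘ (p ∘ t)
      Z-cover : Cover 𝒞 (Pullback.universal (pullback b f) commute)

  record SmallMapAxioms (heyting : PositiveHeyting 𝒞) : Set (o ⊔ ℓ ⊔ e ⊔ s) where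
    open PositiveHeyting heyting
    field
      A1 : ∀ {P A B C} {p₁ : P ⇒ A} {p₂ : P ⇒ B} {f : A ⇒ C} {g : B ⇒ C} →
           IsPullback 𝒞 p₁ p₂ f g → Small f → Small p₂
      A2 : ∀ {P A B C} {p₁ : P ⇒ A} {p₂ : P ⇒ B} {f : A ⇒ C} {g : B ⇒ C} →
           IsPullback 𝒞 p₁ p₂ f g → Cover 𝒞 g → Small p₂ → Small f
      A3 : ∀ {X X′ Y Y′} {f : X ⇒ Y} {f′ : X′ ⇒ Y′} → Small f → Small f′ →
           Small (Coprod.[_,_] X X′ (Coprod.i₁ Y Y′ ∘ f) (Coprod.i₂ Y Y′ ∘ f′))
      A4-0 : Small (! {⊥})
      A4-1 : Small (! {⊤})
      A4-2 : Small (! {⊤ ⊕ ⊤})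
      A5 : ∀ {A B C} {f : A ⇒ B} {g : B ⇒ C} → Small g → Small f → Small (g ∘ f)
      A6 : ∀ {A B C} {f : A ⇒ B} {g : B ⇒ C} → Small (g ∘ f) → Cover 𝒞 f → Small g
      A7 : ∀ {Y X A} (p : Y ⇒ X) (f : X ⇒ A) → Cover 𝒞 p → Small f → Collection finiteLimits p f
      A8 : ∀ {X Y} (f : Y ⇒ X) → Small f → (M : Subobject 𝒞 Y) →
           Small (Subobject.arrow M) → Small (Subobject.arrow (∀[ f ] M))
      A9 : ∀ X → Small (diagonal X)

  record CategoryWithSmallMaps : Set (o ⊔ ℓ ⊔ e ⊔ s) where
    field
      positiveHeyting : PositiveHeyting 𝒞
      smallMapAxioms  : SmallMapAxioms positiveHeyting
    open PositiveHeyting positiveHeyting public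
    open SmallMapAxioms smallMapAxioms public

  -- f is a pullback of π, after pulling back along a cover of its codomain.
  record LocallyPullbackOf {E U B A} (π : E ⇒ U) (f : B ⇒ A) : Set (o ⊔ ℓ ⊔ e) where
    field
      {B′ A′} : Obj
      f′      : B′ ⇒ A′
      c       : A′ ⇒ A
      c′      : B′ ⇒ B
      u       : A′ ⇒ U
      u′      : B′ ⇒ E
      c-cover : Cover 𝒞 c
      left    : IsPullback 𝒞 c′ f′ f c
      right   : IsPullback 𝒞 u′ f′ π u

  record UniversalSmallMap : Set (o ⊔ ℓ ⊔ e ⊔ s) where
    field
      {E U}     : Obj
      π         : E ⇒ U
      π-small   : Small π
      universal : ∀ {B A} (f : B ⇒ A) → Small f → LocallyPullbackOf π f

  record PredicativeCategoryWithSmallMaps : Set (o ⊔ ℓ ⊔ e ⊔ s) where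
    field
      categoryWithSmallMaps : CategoryWithSmallMaps
    open CategoryWithSmallMaps categoryWithSmallMaps public
    field
      exponentiable     : ∀ {B A} (f : B ⇒ A) → Small f → ExponentiableMap 𝒞 finiteLimits f
      W-types           : ∀ {B A} (f : B ⇒ A) (f-small : Small f) →
                          Polynomial.WType 𝒞 finiteLimits f (exponentiable f f-small)
      nno               : NaturalNumbersObject 𝒞 finiteLimits
      nno-small         : Small (! {NaturalNumbersObject.N nno})
      universalSmallMap : UniversalSmallMap
      quotients         : ∀ {R X} (r₁ r₂ : R ⇒ X) → IsEquivalenceRelation 𝒞 finiteLimits r₁ r₂ →
                          Small (Product.⟨_,_⟩ (product X X) r₁ r₂) →
                          StableQuotient 𝒞 finiteLimits r₁ r₂

-- The equations are stated for generalised elements at an arbitrary stage T.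
-- They quantify over the proofs that a composite or an action is defined; such
-- proofs always exist, and the arrow obtained does not depend on them.

module _ {o ℓ e} {𝒞 : Category o ℓ e} (lim : FiniteLimits 𝒞) where
  open Category 𝒞
  open FiniteLimits lim

  record InternalCategory : Set (o ⊔ ℓ ⊔ e) where
    field
      {C₀ C₁} : Obj
      dom cod : C₁ ⇒ C₀
      ident   : C₀ ⇒ C₁
    module Composable = Pullback (pullback dom cod)
    field
      comp : Composable.P ⇒ C₁

    compose : ∀ {T} (f g : T ⇒ C₁) → dom ∘ f ≈ cod ∘ g → T ⇒ C₁
    compose f g eq = comp ∘ Composable.universal {h = f} {k = g} eq

    field
      dom-ident : dom ∘ ident ≈ id
      cod-ident : cod ∘ ident ≈ id
      dom-comp  : dom ∘ comp ≈ dom ∘ Composable.p₂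
      cod-comp  : cod ∘ comp ≈ cod ∘ Composable.p₁

      ident-left  : ∀ {T} (f : T ⇒ C₁) eq → compose (ident ∘ (cod ∘ f)) f eq ≈ f
      ident-right : ∀ {T} (f : T ⇒ C₁) eq → compose f (ident ∘ (dom ∘ f)) eq ≈ f
      comp-assoc  : ∀ {T} (f g h : T ⇒ C₁) fg gh fg-h f-gh →
                    compose (compose f g fg) h fg-h ≈ compose f (compose g h gh) f-gh

  module _ (C : InternalCategory) where
    open InternalCategory C

    record Presheaf : Set (o ⊔ ℓ ⊔ e) where
      field
        underlying : SliceObj 𝒞 C₀
      open SliceObj underlying public
      module Actionable = Pullback (pullback arr cod)
      field
        action : Actionable.P ⇒ carrier

      act : ∀ {T} (x : T ⇒ carrier) (f : T ⇒ C₁) → arr ∘ x ≈ cod ∘ f → T ⇒ carrier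
      act x f eq = action ∘ Actionable.universal {h = x} {k = f} eq

      field
        arr-action : arr ∘ action ≈ dom ∘ Actionable.p₂
        act-ident  : ∀ {T} (x : T ⇒ carrier) eq → act x (ident ∘ (arr ∘ x)) eq ≈ x
        act-comp   : ∀ {T} (x : T ⇒ carrier) (f g : T ⇒ C₁) xf xf-g fg x-fg →
                     act (act x f xf) g xf-g ≈ act x (compose f g fg) x-fg

    record PresheafMap (P Q : Presheaf) : Set (o ⊔ ℓ ⊔ e) where
      private
        module P = Presheaf P
        module Q = Presheaf Q
      field
        underlying : SliceHom 𝒞 P.underlying Q.underlying
      open SliceHom underlying public
      field
        equivariant : ∀ {T} (x : T ⇒ P.carrier) (f : T ⇒ C₁) xf hx-f →
                      h ∘ P.act x f xf ≈ Q.act (h ∘ x) f hx-f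

    Psh : Category (o ⊔ ℓ ⊔ e) (o ⊔ ℓ ⊔ e) e
    Psh = record
      { Obj = Presheaf
      ; _⇒_ = PresheafMap
      ; _≈_ = λ F G → Slice/C₀._≈_ (PresheafMap.underlying F) (PresheafMap.underlying G)
      ; id  = λ {P} → record
        { underlying  = Slice/C₀.id
        ; equivariant = λ x f xf hx-f → Equiv.trans identityˡ (act-resp P (Equiv.sym identityˡ))
        }
      ; _∘_ = λ {P} {Q} {R} G F →
          let module F = PresheafMap F
              module G = PresheafMap G
          in record
        { underlying  = G.underlying Slice/C₀.∘ F.underlying
        ; equivariant = λ x f xf hx-f →
            let eq₁ = Equiv.trans (Equiv.sym assoc) (Equiv.trans (∘-resp-≈ˡ F.△) xf)
                eq₂ = Equiv.trans (∘-resp-≈ʳ (Equiv.sym assoc)) hx-f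
            in Equiv.trans assoc
              (Equiv.trans (∘-resp-≈ʳ (F.equivariant x f xf eq₁))
              (Equiv.trans (G.equivariant (F.h ∘ x) f eq₁ eq₂)
                           (act-resp R (Equiv.sym assoc))))
        }
      ; assoc     = assoc
      ; identityˡ = identityˡ
      ; identityʳ = identityʳ
      ; equiv     = record { refl = Equiv.refl ; sym = Equiv.sym ; trans = Equiv.trans }
      ; ∘-resp-≈  = ∘-resp-≈
      }
      where
      module Slice/C₀ = Category (Slice 𝒞 C₀)

      module _ (P : Presheaf) where
        open Presheaf P

        act-resp : ∀ {T} {x y : T ⇒ carrier} {f : T ⇒ C₁} {xf yf} → x ≈ y → act x f xf ≈ act y f yf
        act-resp x≈y = ∘-resp-≈ʳ
          (Actionable.unique (Equiv.trans Actionable.p₁∘universal x≈y) Actionable.p₂∘universal)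

    PointwiseSmall : ∀ {s} → MapClass 𝒞 s → MapClass Psh s
    PointwiseSmall 𝒮 = record
      { Small  = λ F → MapClass.Small 𝒮 (PresheafMap.h F)
      ; resp-≈ = MapClass.resp-≈ 𝒮
      }

module Submission where

-- Pullbacks, images, finite coproducts and the initial object of presheaves are
-- computed in 𝓔, so the forgetful functor preserves and reflects pullbacks, covers
-- and monos; this settles every axiom except universal quantification and
-- collection. Universal quantification is the largest subpresheaf of the one
-- computed in 𝓔; it is ∀ along the projection X ×_{C₀} C₁ → X, which is small since
-- cod is. For collection along Y ↠ X → A, apply collection in 𝓔 to the pullback of
-- Y ↠ X to the object of triples (a , k , x) with f(x) = a · k, which is small over A,
-- and replace the resulting Z → B by the induced map between free presheaves.

open import Defs
open import Level using (_⊔_)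
open import Data.Bool using (Bool; true; false)
open import Data.Unit using (tt) renaming (⊤ to ⊤′)
open import Data.Product using (∃; _,_; proj₁; proj₂)
open import Function.Bundles using (_⇔_; mk⇔; Equivalence)

-- What makes collection hard is the action. Collection in 𝓔 for f alone gives a cover b : B → A in
-- which no arrows act on B. Passing to the free presheaf on B repairs this but adds points (β , k),
-- lying over b(β) · k, so the elements of X over every restriction of b(β) must also be lifted to
-- Y. The triples (a , k , x) gather exactly these fibres into one map to A. The pullback of the
-- triples along b then agrees with the pullback of X to the free presheaf, so a single use of
-- collection in 𝓔 suffices. Smallness of the map between free presheaves, and of diagonals over C₀,
-- comes from one cancellation principle: if q ∘ f is small, so is f.

module CategoryLemmas {o ℓ e} (𝓔 : Category o ℓ e) where
  open Category 𝓔

  infixr 5 _∙_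
  infix  6 _▹_ _◃_

  abstract
    refl : ∀ {A B} {f : A ⇒ B} → f ≈ f
    refl = Equiv.refl

    sym : ∀ {A B} {f g : A ⇒ B} → f ≈ g → g ≈ f
    sym = Equiv.sym

    _∙_ : ∀ {A B} {f g h : A ⇒ B} → f ≈ g → g ≈ h → f ≈ h
    _∙_ = Equiv.trans

    _▹_ : ∀ {A B C} (f : B ⇒ C) {g h : A ⇒ B} → g ≈ h → f ∘ g ≈ f ∘ h
    f ▹ eq = ∘-resp-≈ʳ eq

    _◃_ : ∀ {A B C} {f g : B ⇒ C} → f ≈ g → (h : A ⇒ B) → f ∘ h ≈ g ∘ h
    eq ◃ h = ∘-resp-≈ˡ eq

    pullˡ : ∀ {A B C D} {f : A ⇒ B} {g : B ⇒ C} {h : C ⇒ D} {k : B ⇒ D} →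
            h ∘ g ≈ k → h ∘ (g ∘ f) ≈ k ∘ f
    pullˡ {f = f} eq = sym assoc ∙ eq ◃ f

    pullʳ : ∀ {A B C D} {f : A ⇒ B} {g : B ⇒ C} {h : C ⇒ D} {k : A ⇒ C} →
            g ∘ f ≈ k → (h ∘ g) ∘ f ≈ h ∘ k
    pullʳ {h = h} eq = assoc ∙ h ▹ eq

  split-mono⇒iso : ∀ {A B} {m : A ⇒ B} {s : B ⇒ A} → Mono 𝓔 m → m ∘ s ≈ id → IsIso 𝓔 m
  split-mono⇒iso {m = m} {s} mono eq = record
    { inv  = s
    ; isoˡ = mono (s ∘ m) id (pullˡ eq ∙ identityˡ ∙ sym identityʳ)
    ; isoʳ = eq
    }

  module PullbackLemmas {P A B C} {p₁ : P ⇒ A} {p₂ : P ⇒ B} {f : A ⇒ C} {g : B ⇒ C}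
                        (pb : IsPullback 𝓔 p₁ p₂ f g) where
    open IsPullback pb

    abstract
      commute-at : ∀ {T} (z : T ⇒ P) → f ∘ (p₁ ∘ z) ≈ g ∘ (p₂ ∘ z)
      commute-at z = pullˡ commute ∙ assoc

      ext : ∀ {T} {u v : T ⇒ P} → p₁ ∘ u ≈ p₁ ∘ v → p₂ ∘ u ≈ p₂ ∘ v → u ≈ v
      ext {v = v} eq₁ eq₂ = unique {eq = commute-at v} eq₁ eq₂ ∙ sym (unique refl refl)

    pullback-sym : IsPullback 𝓔 p₂ p₁ g f
    pullback-sym = record
      { commute      = sym commute
      ; universal    = λ eq → universal (sym eq)
      ; p₁∘universal = p₂∘universal
      ; p₂∘universal = p₁∘universal
      ; unique       = λ eq₁ eq₂ → unique eq₂ eq₁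
      }

    -- One composite is enough: `ψ ∘ φ ≈ id` makes `φ` monic, so uniqueness is inherited from P.
    pullback-retract : ∀ {P′} {p₁′ : P′ ⇒ A} {p₂′ : P′ ⇒ B} (φ : P′ ⇒ P) (ψ : P ⇒ P′) →
      p₁ ∘ φ ≈ p₁′ → p₂ ∘ φ ≈ p₂′ → p₁′ ∘ ψ ≈ p₁ → p₂′ ∘ ψ ≈ p₂ → ψ ∘ φ ≈ id →
      IsPullback 𝓔 p₁′ p₂′ f g
    pullback-retract φ ψ φ₁ φ₂ ψ₁ ψ₂ ψφ = record
      { commute      = f ▹ sym φ₁ ∙ commute-at φ ∙ g ▹ φ₂
      ; universal    = λ eq → ψ ∘ universal eq
      ; p₁∘universal = pullˡ ψ₁ ∙ p₁∘universal
      ; p₂∘universal = pullˡ ψ₂ ∙ p₂∘universal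
      ; unique       = λ eq₁ eq₂ → sym identityˡ ∙ sym ψφ ◃ _ ∙ assoc ∙
                         ψ ▹ unique (pullˡ φ₁ ∙ eq₁) (pullˡ φ₂ ∙ eq₂)
      }

-- Internal logic of a positive Heyting category, on generalised elements.

module HeytingLemmas {o ℓ e} {𝓔 : Category o ℓ e} (heyting : PositiveHeyting 𝓔) where
  open Category 𝓔
  open PositiveHeyting heyting
  open CategoryLemmas 𝓔

  infix 4 _∈_

  -- Membership of a generalised element at stage T. Covers, images and ∀ are all handled through
  -- it, so that proofs can follow the set-theoretic argument.
  _∈_ : ∀ {T X} → T ⇒ X → Subobject 𝓔 X → Set (ℓ ⊔ e)
  x ∈ M = ∃ λ z → Subobject.arrow M ∘ z ≈ x

  ∈-resp : ∀ {T X} {x y : T ⇒ X} (M : Subobject 𝓔 X) → x ≈ y → x ∈ M → y ∈ M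
  ∈-resp M eq (z , mz≈x) = z , (mz≈x ∙ eq)

  ∈-∘ : ∀ {S T X} {x : T ⇒ X} (M : Subobject 𝓔 X) (t : S ⇒ T) → x ∈ M → x ∘ t ∈ M
  ∈-∘ M t (z , mz≈x) = z ∘ t , pullˡ mz≈x

  ∈-⁻¹ : ∀ {T X Y} {y : T ⇒ Y} (f : Y ⇒ X) (N : Subobject 𝓔 X) → f ∘ y ∈ N → y ∈ f ⁻¹[ N ]
  ∈-⁻¹ f N (z , eq) = universal (sym eq) , p₁∘universal
    where open Pullback (pullback f (Subobject.arrow N))

  ⁻¹-∈ : ∀ {T X Y} {y : T ⇒ Y} (f : Y ⇒ X) (N : Subobject 𝓔 X) → y ∈ f ⁻¹[ N ] → f ∘ y ∈ N
  ⁻¹-∈ f N (z , eq) = p₂ ∘ z , (pullˡ (sym commute) ∙ pullʳ eq)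
    where open Pullback (pullback f (Subobject.arrow N))

  -- The cover factors through the mono `x ⁻¹[ M ]`, which is therefore invertible; hence membership
  -- may be checked after passing to a cover of the stage.
  ∈-local : ∀ {S T X} {c : S ⇒ T} {x : T ⇒ X} (M : Subobject 𝓔 X) → Cover 𝓔 c → x ∘ c ∈ M → x ∈ M
  ∈-local {x = x} M cover (z , eq) =
    p₂ ∘ inv , (pullˡ (sym commute) ∙ pullʳ isoʳ ∙ identityʳ)
    where
    open Pullback (pullback x (Subobject.arrow M))
    open IsIso (cover p₁ (universal (sym eq)) (Subobject.isMono (x ⁻¹[ M ])) p₁∘universal)

  cover-intro : ∀ {A B} {f : A ⇒ B} → (∀ M → f ∈ M → id ∈ M) → Cover 𝓔 f
  cover-intro p m g mono eq = split-mono⇒iso mono (proj₂ (p (record { isMono = mono }) (g , eq)))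

  cover-elim : ∀ {A B} {f : A ⇒ B} → Cover 𝓔 f → ∀ M → f ∈ M → id ∈ M
  cover-elim cover M f∈M = ∈-local M cover (∈-resp M (sym identityˡ) f∈M)

  cover-cancel : ∀ {A B C} {f : A ⇒ B} {g : B ⇒ C} {h : A ⇒ C} → g ∘ f ≈ h → Cover 𝓔 h → Cover 𝓔 g
  cover-cancel {f = f} eq cover = cover-intro λ M g∈M →
    cover-elim cover M (∈-resp M eq (∈-∘ M f g∈M))

  -- Membership of h in M descends along the cover to g, and restricting g along its section then
  -- yields the identity.
  split∘cover : ∀ {A B C} {f : A ⇒ B} {g : B ⇒ C} {h : A ⇒ C} {s : C ⇒ B} →
                g ∘ f ≈ h → g ∘ s ≈ id → Cover 𝓔 f → Cover 𝓔 h
  split∘cover {s = s} eq split cover = cover-intro λ M h∈M →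
    ∈-resp M split (∈-∘ M s (∈-local M cover (∈-resp M (sym eq) h∈M)))

  imageOf : ∀ {A B} → A ⇒ B → Subobject 𝓔 B
  imageOf f = record { isMono = Factorisation.isMono (factorisation f) }

  -- Kripke–Joyal forcing for ∀: reducing x to its image turns a generalised
  -- element into a subobject, where the adjunction applies.
  ∀-intro : ∀ {T X Y} (f : Y ⇒ X) (M : Subobject 𝓔 Y) {x : T ⇒ X} →
            (∀ {S} (t : S ⇒ T) (y : S ⇒ Y) → f ∘ y ≈ x ∘ t → y ∈ M) → x ∈ ∀[ f ] M
  ∀-intro f M {x} p = ∈-resp (∀[ f ] M) factorise
    (∈-∘ (∀[ f ] M) cover (Equivalence.to (∀-adjoint f M (imageOf x))
      (∈-local M (cover-stable T′.isPullback isCover)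
        (p T′.p₁ (F.p₁ ∘ T′.p₂)
          (pullˡ F.commute ∙ assoc ∙ mono ▹ sym T′.commute ∙ pullˡ factorise)))))
    where
    open Factorisation (factorisation x)
    module F = Pullback (pullback f mono)
    module T′ = Pullback (pullback cover F.p₂)

  -- This is the counit of the adjunction, obtained by taking N to be `∀[ f ] M` itself.
  ∀-elim : ∀ {T X Y} (f : Y ⇒ X) (M : Subobject 𝓔 Y) {y : T ⇒ Y} → f ∘ y ∈ ∀[ f ] M → y ∈ M
  ∀-elim f M p with ∈-⁻¹ f (∀[ f ] M) p
  ... | z , eq = ∈-resp M eq (∈-∘ M z (Equivalence.from (∀-adjoint f M (∀[ f ] M)) (id , identityʳ)))

  ⊥-ext : ∀ {X Y} → X ⇒ ⊥ → {f g : X ⇒ Y} → f ≈ g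
  ⊥-ext x = IsInitial.¡-unique (⊥-stable x) _ ∙ sym (IsInitial.¡-unique (⊥-stable x) _)

  -- Indexing the two injections by `Bool` lets one argument treat both summands.
  inj : ∀ (A : Bool → Obj) b → A b ⇒ A true ⊕ A false
  inj A true  = Coprod.i₁ (A true) (A false)
  inj A false = Coprod.i₂ (A true) (A false)

  -- Case distinction on a generalised element of a sum: by stability of coproducts, z splits its
  -- stage T into the parts where it lies in either summand, so arrows out of T can be defined and
  -- compared on the parts.
  module Cases (A : Bool → Obj) {T} (z : T ⇒ A true ⊕ A false) where
    module Part b = Pullback (pullback (inj A b) z)
    open IsCoproduct (⊕-stable (Part.isPullback true) (Part.isPullback false))

    case : ∀ {Z} → (∀ b → Part.P b ⇒ Z) → T ⇒ Z
    case φ = [ φ true , φ false ]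

    abstract
      case-inj : ∀ b {S Z} {φ : ∀ b → Part.P b ⇒ Z} {t : S ⇒ T} {x : S ⇒ A b} (eq : inj A b ∘ x ≈ z ∘ t) →
                 case φ ∘ t ≈ φ b ∘ Part.universal b eq
      case-inj true  {φ = φ} eq = case φ ▹ sym (Part.p₂∘universal true) ∙ pullˡ inject₁
      case-inj false {φ = φ} eq = case φ ▹ sym (Part.p₂∘universal false) ∙ pullˡ inject₂

      cases-ext : ∀ {Z} {u v : T ⇒ Z} →
                  (∀ b {S} (t : S ⇒ T) (x : S ⇒ A b) → inj A b ∘ x ≈ z ∘ t → u ∘ t ≈ v ∘ t) → u ≈ v
      cases-ext {u = u} {v} p = unique (on-part true) (on-part false) ∙ sym (unique refl refl)
        where
        on-part : ∀ b → u ∘ Part.p₂ b ≈ v ∘ Part.p₂ b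
        on-part b = p b (Part.p₂ b) (Part.p₁ b) (Part.commute b)

-- Presheaves through their action on generalised elements; finite limits.

module PresheafLemmas {o ℓ e} {𝓔 : Category o ℓ e} (lim : FiniteLimits 𝓔) (C : InternalCategory lim) where
  open Category 𝓔
  open FiniteLimits lim
  open CategoryLemmas 𝓔
  open InternalCategory C

  Ps : Set (o ⊔ ℓ ⊔ e)
  Ps = Presheaf lim C

  infix 4 _⟶_
  _⟶_ : Ps → Ps → Set (o ⊔ ℓ ⊔ e)
  _⟶_ = PresheafMap lim C

  PSH : Category (o ⊔ ℓ ⊔ e) (o ⊔ ℓ ⊔ e) e
  PSH = Psh lim C

  open PresheafMap using (h; △; equivariant)

  abstract
    compose-cong : ∀ {T} {f f′ g g′ : T ⇒ C₁} {p q} → f ≈ f′ → g ≈ g′ → compose f g p ≈ compose f′ g′ q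
    compose-cong eq₁ eq₂ = comp ▹ Composable.unique (Composable.p₁∘universal ∙ eq₁) (Composable.p₂∘universal ∙ eq₂)

    compose-natural : ∀ {S T} {f g : T ⇒ C₁} {t : S ⇒ T} {p q} → compose f g p ∘ t ≈ compose (f ∘ t) (g ∘ t) q
    compose-natural = pullʳ (Composable.unique (pullˡ Composable.p₁∘universal) (pullˡ Composable.p₂∘universal))

    dom-compose : ∀ {T} {f g : T ⇒ C₁} {p} → dom ∘ compose f g p ≈ dom ∘ g
    dom-compose = pullˡ dom-comp ∙ pullʳ Composable.p₂∘universal

    cod-compose : ∀ {T} {f g : T ⇒ C₁} {p} → cod ∘ compose f g p ≈ cod ∘ f
    cod-compose = pullˡ cod-comp ∙ pullʳ Composable.p₁∘universal

  module _ (P : Ps) where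
    open Presheaf P

    abstract
      -- The definedness proofs p and q are unrelated, so with `refl` twice this also says that the
      -- value does not depend on them.
      act-cong : ∀ {T} {x y : T ⇒ carrier} {f g : T ⇒ C₁} {p q} → x ≈ y → f ≈ g → act x f p ≈ act y g q
      act-cong eq₁ eq₂ = action ▹ Actionable.unique (Actionable.p₁∘universal ∙ eq₁) (Actionable.p₂∘universal ∙ eq₂)

      act-natural : ∀ {S T} {x : T ⇒ carrier} {f : T ⇒ C₁} {t : S ⇒ T} {p q} →
                    act x f p ∘ t ≈ act (x ∘ t) (f ∘ t) q
      act-natural = pullʳ (Actionable.unique (pullˡ Actionable.p₁∘universal) (pullˡ Actionable.p₂∘universal))

      arr-act : ∀ {T} {x : T ⇒ carrier} {f : T ⇒ C₁} {p} → arr ∘ act x f p ≈ dom ∘ f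
      arr-act = pullˡ arr-action ∙ pullʳ Actionable.p₂∘universal

  module _ {P Q : Ps} (F : P ⟶ Q) where
    private
      module P = Presheaf P
      module Q = Presheaf Q

    abstract
      arr-at : ∀ {T} (x : T ⇒ P.carrier) → Q.arr ∘ (h F ∘ x) ≈ P.arr ∘ x
      arr-at x = pullˡ (△ F)

      act-at : ∀ {T} {x : T ⇒ P.carrier} {f : T ⇒ C₁} {p} {y} {q} → h F ∘ x ≈ y → h F ∘ P.act x f p ≈ Q.act y f q
      act-at {x = x} {f} {p} eq = equivariant F x f p (arr-at x ∙ p) ∙ act-cong Q eq refl

  -- An action is determined by its effect on generalised elements, provided
  -- that effect is natural in the stage.
  Operation : SliceObj 𝓔 C₀ → Set (o ⊔ ℓ ⊔ e)
  Operation X = ∀ {T} (x : T ⇒ carrier) (f : T ⇒ C₁) → arr ∘ x ≈ cod ∘ f → T ⇒ carrier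
    where open SliceObj X

  record IsAction (X : SliceObj 𝓔 C₀) (_·_[_] : Operation X) : Set (o ⊔ ℓ ⊔ e) where
    open SliceObj X
    field
      cong    : ∀ {T} {x y : T ⇒ carrier} {f g : T ⇒ C₁} {p q} → x ≈ y → f ≈ g → x · f [ p ] ≈ y · g [ q ]
      natural : ∀ {S T} {x : T ⇒ carrier} {f : T ⇒ C₁} {t : S ⇒ T} {p q} →
                x · f [ p ] ∘ t ≈ (x ∘ t) · f ∘ t [ q ]
      arr-·   : ∀ {T} {x : T ⇒ carrier} {f : T ⇒ C₁} {p} → arr ∘ x · f [ p ] ≈ dom ∘ f
      ·-ident : ∀ {T} (x : T ⇒ carrier) eq → x · ident ∘ (arr ∘ x) [ eq ] ≈ x
      ·-comp  : ∀ {T} (x : T ⇒ carrier) (f g : T ⇒ C₁) xf xf-g fg x-fg →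
                (x · f [ xf ]) · g [ xf-g ] ≈ x · compose f g fg [ x-fg ]

  module _ {X : SliceObj 𝓔 C₀} (_·_[_] : Operation X) (isAction : IsAction X _·_[_]) where
    open SliceObj X
    open IsAction isAction
    private module Act = Pullback (pullback arr cod)

    abstract
      -- A Yoneda argument: every actionable pair is a restriction of the generic one, the two
      -- pullback projections, so naturality recovers the operation from its value there.
      generic-· : ∀ {T} {x : T ⇒ carrier} {f : T ⇒ C₁} {p} →
                  Act.p₁ · Act.p₂ [ Act.commute ] ∘ Act.universal p ≈ x · f [ p ]
      generic-· {p = p} = natural {q = PullbackLemmas.commute-at Act.isPullback _}
                          ∙ cong Act.p₁∘universal Act.p₂∘universal

      generic-ident : ∀ {T} (x : T ⇒ carrier) eq →
        Act.p₁ · Act.p₂ [ Act.commute ] ∘ Act.universal {h = x} {k = ident ∘ (arr ∘ x)} eq ≈ x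
      generic-ident x eq = generic-· ∙ ·-ident x eq

      generic-comp : ∀ {T} (x : T ⇒ carrier) (f g : T ⇒ C₁) xf xf-g fg x-fg →
        Act.p₁ · Act.p₂ [ Act.commute ] ∘
          Act.universal {h = Act.p₁ · Act.p₂ [ Act.commute ] ∘ Act.universal {h = x} {k = f} xf} {k = g} xf-g ≈
        Act.p₁ · Act.p₂ [ Act.commute ] ∘ Act.universal {h = x} {k = compose f g fg} x-fg
      generic-comp x f g xf xf-g fg x-fg =
        generic-· ∙ cong {q = arr-· ∙ fg} generic-· refl ∙ ·-comp x f g xf _ fg x-fg ∙ sym generic-·

    fromAction : Ps
    fromAction = record
      { underlying = X
      ; action     = Act.p₁ · Act.p₂ [ Act.commute ]
      ; arr-action = arr-·
      ; act-ident  = generic-ident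
      ; act-comp   = generic-comp
      }

    abstract
      act≈· : ∀ {T} {x : T ⇒ carrier} {f : T ⇒ C₁} {p} → Presheaf.act fromAction x f p ≈ x · f [ p ]
      act≈· = generic-·

      mapFrom-equivariant : (Q : Ps) (k : carrier ⇒ Presheaf.carrier Q) →
        (∀ {T} (x : T ⇒ carrier) (f : T ⇒ C₁) p q → k ∘ x · f [ p ] ≈ Presheaf.act Q (k ∘ x) f q) →
        ∀ {T} (x : T ⇒ carrier) (f : T ⇒ C₁) p q → k ∘ Presheaf.act fromAction x f p ≈ Presheaf.act Q (k ∘ x) f q
      mapFrom-equivariant Q k k-· x f p q = k ▹ generic-· ∙ k-· x f p q

    mapFrom : (Q : Ps) (k : carrier ⇒ Presheaf.carrier Q) → Presheaf.arr Q ∘ k ≈ arr →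
              (∀ {T} (x : T ⇒ carrier) (f : T ⇒ C₁) p q → k ∘ x · f [ p ] ≈ Presheaf.act Q (k ∘ x) f q) →
              fromAction ⟶ Q
    mapFrom Q k arr-k k-· = record
      { underlying  = slicehom {h = k} arr-k
      ; equivariant = mapFrom-equivariant Q k k-·
      }

  -- The carrier is C₀ itself, one point in each fibre, so restricting along f can only lead to the
  -- point over its domain.
  terminalOperation : Operation (sliceobj id)
  terminalOperation x f p = dom ∘ f

  abstract
    terminalIsAction : IsAction (sliceobj id) terminalOperation
    terminalIsAction = record
      { cong    = λ _ eq → dom ▹ eq
      ; natural = assoc
      ; arr-·   = identityˡ
      ; ·-ident = λ x p → pullˡ dom-ident ∙ identityˡ ∙ identityˡ
      ; ·-comp  = λ x f g xf xf-g fg x-fg → sym dom-compose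
      }

  𝟙 : Ps
  𝟙 = fromAction terminalOperation terminalIsAction

  𝟙-terminal : IsTerminal PSH 𝟙
  𝟙-terminal = record
    { !        = λ {P} → record
        { underlying  = slicehom {h = Presheaf.arr P} identityˡ
        ; equivariant = λ x f xf hx-f → arr-act P ∙ sym (act≈· terminalOperation terminalIsAction)
        }
    ; !-unique = λ F → sym identityˡ ∙ △ F
    }

  -- An operation that the jointly monic family `m` turns into the given actions inherits all action
  -- laws from them. Pullbacks use it with two legs, subpresheaves with one. The index `i₀` provides
  -- a leg through which `arr` can be computed.
  module JointlyMonic
    {I : Set} (P : I → Ps) (X : SliceObj 𝓔 C₀)
    (m : ∀ i → SliceObj.carrier X ⇒ Presheaf.carrier (P i))
    (arr-m : ∀ i → Presheaf.arr (P i) ∘ m i ≈ SliceObj.arr X)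
    (m-ext : ∀ {T} {u v : T ⇒ SliceObj.carrier X} → (∀ i → m i ∘ u ≈ m i ∘ v) → u ≈ v)
    (i₀ : I)
    where
    open SliceObj X

    abstract
      m-arr : ∀ {T} i {x : T ⇒ carrier} {f : T ⇒ C₁} → arr ∘ x ≈ cod ∘ f → Presheaf.arr (P i) ∘ (m i ∘ x) ≈ cod ∘ f
      m-arr i p = pullˡ (arr-m i) ∙ p

    module _
      (a : Operation X)
      (m-a : ∀ i {T} (x : T ⇒ carrier) (f : T ⇒ C₁) p →
             m i ∘ a x f p ≈ Presheaf.act (P i) (m i ∘ x) f (m-arr i p))
      where

      abstract
        inducedIsAction : IsAction X a
        inducedIsAction = record
          { cong    = λ eq₁ eq₂ → m-ext λ i → m-a i _ _ _ ∙ act-cong (P i) (m i ▹ eq₁) eq₂ ∙ sym (m-a i _ _ _)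
          ; natural = λ {S} {T} {x} {f} {t} {p} {q} → m-ext λ i → pullˡ (m-a i x f p) ∙
              act-natural (P i) {q = pullˡ (m-arr i p) ∙ assoc} ∙ act-cong (P i) assoc refl ∙ sym (m-a i _ _ q)
          ; arr-·   = sym (arr-m i₀) ◃ _ ∙ pullʳ (m-a i₀ _ _ _) ∙ arr-act (P i₀)
          ; ·-ident = λ x p → m-ext λ i → m-a i _ _ p ∙
              act-cong (P i) {q = cod-id i x} refl (ident ▹ sym (pullˡ (arr-m i))) ∙
              Presheaf.act-ident (P i) (m i ∘ x) _
          ; ·-comp  = λ x f g xf xf-g fg x-fg → m-ext λ i → m-a i _ _ xf-g ∙
              act-cong (P i) {q = arr-act (P i) ∙ fg} (m-a i x f xf) refl ∙
              Presheaf.act-comp (P i) (m i ∘ x) f g (m-arr i xf) _ fg (m-arr i x-fg) ∙ sym (m-a i _ _ x-fg)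
          }
          where
          cod-id : ∀ i {T} (x : T ⇒ carrier) →
            Presheaf.arr (P i) ∘ (m i ∘ x) ≈ cod ∘ (ident ∘ (Presheaf.arr (P i) ∘ (m i ∘ x)))
          cod-id i x = sym (pullˡ cod-ident ∙ identityˡ)

        m-equivariant : ∀ i {T} (x : T ⇒ carrier) (f : T ⇒ C₁) p q →
                        m i ∘ a x f p ≈ Presheaf.act (P i) (m i ∘ x) f q
        m-equivariant i x f p q = m-a i x f p ∙ act-cong (P i) refl refl

      inducedMap : ∀ i → fromAction a inducedIsAction ⟶ P i
      inducedMap i = mapFrom a inducedIsAction (P i) (m i) (arr-m i) (m-equivariant i)

  -- To map into M it is enough to find the arrow in 𝓔: equivariance is tested after each `m i`,
  -- where it becomes that of `G i`.
  module _ {I : Set} {M : Ps} {P : I → Ps} (m : ∀ i → M ⟶ P i)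
    (m-ext : ∀ {T} {u v : T ⇒ Presheaf.carrier M} → (∀ i → h (m i) ∘ u ≈ h (m i) ∘ v) → u ≈ v) (i₀ : I)
    {Q : Ps} (G : ∀ i → Q ⟶ P i) (k : Presheaf.carrier Q ⇒ Presheaf.carrier M)
    (mk≈G : ∀ i → h (m i) ∘ k ≈ h (G i))
    where

    abstract
      arr-lift : Presheaf.arr M ∘ k ≈ Presheaf.arr Q
      arr-lift = sym (△ (m i₀)) ◃ k ∙ pullʳ (mk≈G i₀) ∙ △ (G i₀)

      lift-equivariant : ∀ {T} (x : T ⇒ Presheaf.carrier Q) (f : T ⇒ C₁) p q →
                         k ∘ Presheaf.act Q x f p ≈ Presheaf.act M (k ∘ x) f q
      lift-equivariant x f p q = m-ext λ i →
        pullˡ (mk≈G i) ∙ act-at (G i) {q = arr-at (m i) (k ∘ x) ∙ q} (sym (pullˡ (mk≈G i))) ∙ sym (act-at (m i) refl)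

    liftMap : Q ⟶ M
    liftMap = record { underlying = slicehom {h = k} arr-lift ; equivariant = lift-equivariant }

  monoLift : ∀ {M Q P : Ps} (m : M ⟶ Q) → Mono 𝓔 (h m) → (G : P ⟶ Q)
             (k : Presheaf.carrier P ⇒ Presheaf.carrier M) → h m ∘ k ≈ h G → P ⟶ M
  monoLift m mono G k mk≈G =
    liftMap {I = ⊤′} (λ _ → m) (λ eq → mono _ _ (eq tt)) tt (λ _ → G) k (λ _ → mk≈G)

  -- Pullbacks of presheaves, and what the forgetful functor preserves.

  module Pull {P Q R : Ps} (F : P ⟶ R) (G : Q ⟶ R) where
    private
      module P = Presheaf P
      module Q = Presheaf Q
      module R = Presheaf R
      module Pb = Pullback (pullback (h F) (h G))
      open PullbackLemmas Pb.isPullback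

      legs : Bool → Ps
      legs true  = P
      legs false = Q

      object : SliceObj 𝓔 C₀
      object = sliceobj (P.arr ∘ Pb.p₁)

      leg : ∀ i → Pb.P ⇒ Presheaf.carrier (legs i)
      leg true  = Pb.p₁
      leg false = Pb.p₂

      abstract
        arr-leg : ∀ i → Presheaf.arr (legs i) ∘ leg i ≈ P.arr ∘ Pb.p₁
        arr-leg true  = refl
        arr-leg false = sym (△ G) ◃ _ ∙ pullʳ (sym Pb.commute) ∙ pullˡ (△ F)

        leg-ext : ∀ {T} {u v : T ⇒ Pb.P} → (∀ i → leg i ∘ u ≈ leg i ∘ v) → u ≈ v
        leg-ext eq = ext (eq true) (eq false)

      open JointlyMonic legs object leg arr-leg leg-ext true

      abstract
        acts-agree : ∀ {T} (z : T ⇒ Pb.P) (f : T ⇒ C₁) (p : (P.arr ∘ Pb.p₁) ∘ z ≈ cod ∘ f) →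
                     h F ∘ P.act (Pb.p₁ ∘ z) f (m-arr true p) ≈ h G ∘ Q.act (Pb.p₂ ∘ z) f (m-arr false p)
        acts-agree z f p = act-at F {q = arr-at G _ ∙ m-arr false p} (commute-at z) ∙ sym (act-at G refl)

      a : Operation object
      a z f p = Pb.universal (acts-agree z f p)

      abstract
        leg-a : ∀ i {T} (z : T ⇒ Pb.P) (f : T ⇒ C₁) p →
                leg i ∘ a z f p ≈ Presheaf.act (legs i) (leg i ∘ z) f (m-arr i p)
        leg-a true  z f p = Pb.p₁∘universal
        leg-a false z f p = Pb.p₂∘universal

    pullbackPresheaf : Ps
    pullbackPresheaf = fromAction a (inducedIsAction a leg-a)

    projection : ∀ i → pullbackPresheaf ⟶ legs i
    projection = inducedMap a leg-a

    pairing : ∀ {X} (H : X ⟶ P) (K : X ⟶ Q) → h F ∘ h H ≈ h G ∘ h K → X ⟶ pullbackPresheaf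
    pairing {X} H K eq = liftMap projection leg-ext true maps (Pb.universal eq)
                           λ { true → Pb.p₁∘universal ; false → Pb.p₂∘universal }
      where
      maps : ∀ i → X ⟶ legs i
      maps true  = H
      maps false = K

    presheafPullback : Pullback PSH F G
    presheafPullback = record
      { P  = pullbackPresheaf
      ; p₁ = projection true
      ; p₂ = projection false
      ; isPullback = record
        { commute      = Pb.commute
        ; universal    = λ {_} {H} {K} → pairing H K
        ; p₁∘universal = Pb.p₁∘universal
        ; p₂∘universal = Pb.p₂∘universal
        ; unique       = Pb.unique
        }
      }
  open Pull public using (presheafPullback)

  presheafLimits : FiniteLimits PSH
  presheafLimits = record { ⊤ = 𝟙 ; isTerminal = 𝟙-terminal ; pullback = presheafPullback }

  module _ {P A B D : Ps} {p₁ : P ⟶ A} {p₂ : P ⟶ B} {F : A ⟶ D} {G : B ⟶ D}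
           (pb : IsPullback PSH p₁ p₂ F G) where
    private
      module pb = IsPullback pb
      module Pb = Pullback (presheafPullback F G)
      φ : P ⟶ Pb.P
      φ = Pb.universal {h = p₁} {k = p₂} pb.commute
      ψ : Pb.P ⟶ P
      ψ = pb.universal {h = Pb.p₁} {k = Pb.p₂} Pb.commute

      abstract
        φ₁ : Pullback.p₁ (pullback (h F) (h G)) ∘ h φ ≈ h p₁
        φ₁ = Pb.p₁∘universal {h = p₁} {k = p₂} {eq = pb.commute}
        φ₂ : Pullback.p₂ (pullback (h F) (h G)) ∘ h φ ≈ h p₂
        φ₂ = Pb.p₂∘universal {h = p₁} {k = p₂} {eq = pb.commute}
        ψ₁ : h p₁ ∘ h ψ ≈ Pullback.p₁ (pullback (h F) (h G))
        ψ₁ = pb.p₁∘universal {h = Pb.p₁} {k = Pb.p₂} {eq = Pb.commute}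
        ψ₂ : h p₂ ∘ h ψ ≈ Pullback.p₂ (pullback (h F) (h G))
        ψ₂ = pb.p₂∘universal {h = Pb.p₁} {k = Pb.p₂} {eq = Pb.commute}

        ψφ≈id : h ψ ∘ h φ ≈ id
        ψφ≈id = CategoryLemmas.PullbackLemmas.ext PSH pb
          {u = Category._∘_ PSH ψ φ} {v = Category.id PSH}
          (pullˡ ψ₁ ∙ φ₁ ∙ sym identityʳ) (pullˡ ψ₂ ∙ φ₂ ∙ sym identityʳ)

    -- Any pullback of presheaves is isomorphic to the constructed one, whose underlying square is a
    -- pullback in 𝓔 by construction.
    forget-pullback : IsPullback 𝓔 (h p₁) (h p₂) (h F) (h G)
    forget-pullback = PullbackLemmas.pullback-retract (Pullback.isPullback (pullback (h F) (h G)))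
      (h φ) (h ψ) φ₁ φ₂ ψ₁ ψ₂ ψφ≈id

  -- The kernel pair of F as a presheaf has the kernel pair of `h F` as its carrier. Monicity
  -- identifies its two projections, and u and v factor through them.
  forget-mono : ∀ {P Q : Ps} {F : P ⟶ Q} → Mono PSH F → Mono 𝓔 (h F)
  forget-mono {F = F} mono u v eq =
    sym Pb.p₁∘universal ∙ mono K.p₁ K.p₂ K.commute ◃ Pb.universal eq ∙ Pb.p₂∘universal
    where
    module Pb = Pullback (pullback (h F) (h F))
    module K = Pullback (presheafPullback F F)

  forgetSub : ∀ {P : Ps} → Subobject PSH P → Subobject 𝓔 (Presheaf.carrier P)
  forgetSub M = record { isMono = forget-mono {F = Subobject.arrow M} (Subobject.isMono M) }

  reflect-iso : ∀ {P Q : Ps} {F : P ⟶ Q} → Mono 𝓔 (h F) → IsIso 𝓔 (h F) → IsIso PSH F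
  reflect-iso {Q = Q} {F = F} mono iso = record
    { inv  = monoLift F mono (Category.id PSH {Q}) inv isoʳ
    ; isoˡ = isoˡ
    ; isoʳ = isoʳ
    }
    where open IsIso iso

  module Sub (Q : Ps) (M : Subobject 𝓔 (Presheaf.carrier Q)) where
    private
      module Q = Presheaf Q
      module M = Subobject M

    -- Bare existence of w suffices: since the inclusion is monic, w is unique, and naturality in
    -- the stage follows.
    ClosedUnderAction : Set (o ⊔ ℓ ⊔ e)
    ClosedUnderAction = ∀ {T} (z : T ⇒ M.domain) (f : T ⇒ C₁) p → ∃ λ w → M.arrow ∘ w ≈ Q.act (M.arrow ∘ z) f p

    module _ (closed : ClosedUnderAction) where
      private
        open JointlyMonic {I = ⊤′} (λ _ → Q) (sliceobj (Q.arr ∘ M.arrow)) (λ _ → M.arrow) (λ _ → refl)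
                          (λ eq → M.isMono _ _ (eq tt)) tt

        a : Operation (sliceobj (Q.arr ∘ M.arrow))
        a z f p = proj₁ (closed z f (m-arr tt p))

        abstract
          arrow-a : ∀ i {T} (z : T ⇒ M.domain) (f : T ⇒ C₁) p →
                    M.arrow ∘ a z f p ≈ Q.act (M.arrow ∘ z) f (m-arr i p)
          arrow-a _ z f p = proj₂ (closed z f (m-arr tt p))

      subpresheaf : Subobject PSH Q
      subpresheaf = record
        { domain = fromAction a (inducedIsAction a arrow-a)
        ; arrow  = inducedMap a arrow-a tt
        ; isMono = λ U V → M.isMono (h U) (h V)
        }
  open Sub public using (subpresheaf)

-- The positive Heyting structure on presheaves.

module PresheafHeyting {o ℓ e} {𝓔 : Category o ℓ e} (heyting : PositiveHeyting 𝓔)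
                       (C : InternalCategory (PositiveHeyting.finiteLimits heyting)) where
  open Category 𝓔
  open PositiveHeyting heyting
  open CategoryLemmas 𝓔
  open HeytingLemmas heyting
  open InternalCategory C
  open PresheafLemmas finiteLimits C
  open PresheafMap using (h)

  reflect-cover : ∀ {P Q : Ps} (F : P ⟶ Q) → Cover 𝓔 (h F) → Cover PSH F
  reflect-cover F isCover m g mono eq =
    reflect-iso (forget-mono {F = m} mono) (isCover (h m) (h g) (forget-mono {F = m} mono) eq)

  module Image {P Q : Ps} (F : P ⟶ Q) where
    private
      module P = Presheaf P
      module Q = Presheaf Q
      open Factorisation (factorisation (h F))

      abstract
        -- A generalised element z of the image lifts to P only after pulling the cover back along
        -- z. There the action of P restricts the lift, and membership in the image descends along
        -- that cover.
        image-closed : Sub.ClosedUnderAction Q (imageOf (h F))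
        image-closed z f p = ∈-local (imageOf (h F)) (cover-stable isPullback isCover)
          (cover ∘ P.act p₁ (f ∘ p₂) arr-p₁ ,
            (pullˡ factorise ∙ act-at F {q = pullˡ p ∙ assoc} (sym factorise ◃ p₁ ∙ pullʳ commute ∙ sym assoc) ∙
             sym (act-natural Q)))
          where
          open Pullback (pullback cover z)
          arr-p₁ : P.arr ∘ p₁ ≈ cod ∘ (f ∘ p₂)
          arr-p₁ = sym (arr-at F p₁) ∙ Q.arr ▹ (sym factorise ◃ p₁ ∙ pullʳ commute ∙ sym assoc) ∙ pullˡ p ∙ assoc

    presheafImage : Subobject PSH Q
    presheafImage = subpresheaf Q (imageOf (h F)) image-closed

    presheafCover : P ⟶ Subobject.domain presheafImage
    presheafCover = monoLift (Subobject.arrow presheafImage) isMono F cover factorise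

    -- F factors through the subpresheaf carried by its image in 𝓔. As F is a cover, that inclusion
    -- is invertible, so `h F` is a cover followed by an isomorphism.
    forget-cover : Cover PSH F → Cover 𝓔 (h F)
    forget-cover isCoverF = split∘cover factorise (IsIso.isoʳ iso) isCover
      where
      iso : IsIso PSH (Subobject.arrow presheafImage)
      iso = isCoverF (Subobject.arrow presheafImage) presheafCover (Subobject.isMono presheafImage) factorise

    presheafFactorisation : Factorisation PSH F
    presheafFactorisation = record
      { cover     = presheafCover
      ; mono      = Subobject.arrow presheafImage
      ; isCover   = reflect-cover presheafCover isCover
      ; isMono    = Subobject.isMono presheafImage
      ; factorise = factorise
      }
  open Image public using (forget-cover; presheafFactorisation)

  reflect-initial : ∀ {P : Ps} → IsInitial 𝓔 (Presheaf.carrier P) → IsInitial PSH P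
  reflect-initial initial = record
    { ¡        = record
        { underlying  = slicehom {h = I.¡} (⊥-ext I.¡)
        ; equivariant = λ x _ _ _ → ⊥-ext (I.¡ ∘ x)
        }
    ; ¡-unique = λ F → I.¡-unique (h F)
    }
    where module I = IsInitial initial

  initialOperation : Operation (sliceobj ¡)
  initialOperation x f p = x

  abstract
    initialIsAction : IsAction (sliceobj ¡) initialOperation
    initialIsAction = record
      { cong    = λ {_} {x} _ _ → ⊥-ext x
      ; natural = λ {_} {_} {x} {_} {t} → ⊥-ext (x ∘ t)
      ; arr-·   = λ {_} {x} → ⊥-ext x
      ; ·-ident = λ x _ → ⊥-ext x
      ; ·-comp  = λ x _ _ _ _ _ _ → ⊥-ext x
      }

  𝟘 : Ps
  𝟘 = fromAction initialOperation initialIsAction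

  -- Finite coproducts of presheaves.

  module Coprods (P : Bool → Ps) where
    private
      module P b = Presheaf (P b)

    arr⊕ : P.carrier true ⊕ P.carrier false ⇒ C₀
    arr⊕ = Coprod.[_,_] _ _ (P.arr true) (P.arr false)

    abstract
      arr⊕-inj : ∀ b → arr⊕ ∘ inj P.carrier b ≈ P.arr b
      arr⊕-inj true  = Coprod.inject₁ _ _
      arr⊕-inj false = Coprod.inject₂ _ _

      arr-on-part : ∀ b {S T} {z : T ⇒ P.carrier true ⊕ P.carrier false} {f : T ⇒ C₁} {t : S ⇒ T} {x : S ⇒ P.carrier b} →
                    arr⊕ ∘ z ≈ cod ∘ f → inj P.carrier b ∘ x ≈ z ∘ t → P.arr b ∘ x ≈ cod ∘ (f ∘ t)
      arr-on-part b p eq = sym (arr⊕-inj b) ◃ _ ∙ pullʳ eq ∙ pullˡ p ∙ assoc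

    partOperation : ∀ {T} (z : T ⇒ P.carrier true ⊕ P.carrier false) (f : T ⇒ C₁) → arr⊕ ∘ z ≈ cod ∘ f →
                    ∀ b → Cases.Part.P P.carrier z b ⇒ P.carrier true ⊕ P.carrier false
    partOperation z f p b =
      inj P.carrier b ∘ P.act b (Part.p₁ b) (f ∘ Part.p₂ b) (arr-on-part b p (Part.commute b))
      where open Cases P.carrier z

    coproductOperation : Operation (sliceobj arr⊕)
    coproductOperation z f p = Cases.case P.carrier z (partOperation z f p)

    private a = coproductOperation

    abstract
      -- The computation rule for the action on a sum: wherever z comes from summand b, act there
      -- and inject. With `cases-ext` it reduces each law to the same law in a summand.
      a-part : ∀ b {S T} {z : T ⇒ P.carrier true ⊕ P.carrier false} {f : T ⇒ C₁} {p} {t : S ⇒ T} {x : S ⇒ P.carrier b} →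
               inj P.carrier b ∘ x ≈ z ∘ t → ∀ {q} → a z f p ∘ t ≈ inj P.carrier b ∘ P.act b x (f ∘ t) q
      a-part b {z = z} {f} {p} eq = case-inj b {φ = partOperation z f p} eq ∙ pullʳ
        (act-natural (P b) {q = pullˡ (arr-on-part b p (Part.commute b)) ∙ assoc} ∙
         act-cong (P b) (Part.p₁∘universal b) (assoc ∙ f ▹ Part.p₂∘universal b))
        where open Cases P.carrier z

      coproductIsAction : IsAction (sliceobj arr⊕) a
      coproductIsAction = record
        { cong    = λ {_} {x} {y} {f} {g} {p} {q} x≈y f≈g → Cases.cases-ext P.carrier x λ b t z eq →
            a-part b eq {arr-on-part b p eq} ∙ inj P.carrier b ▹ act-cong (P b) refl (f≈g ◃ t) ∙
            sym (a-part b (eq ∙ x≈y ◃ t) {arr-on-part b q (eq ∙ x≈y ◃ t)})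
        ; natural = λ {_} {_} {x} {f} {t} {p} {q} → Cases.cases-ext P.carrier (x ∘ t) λ b s z eq →
            assoc ∙ a-part b (eq ∙ assoc) {arr-on-part b p (eq ∙ assoc)} ∙
            inj P.carrier b ▹ act-cong (P b) refl (sym assoc) ∙ sym (a-part b eq {arr-on-part b q eq})
        ; arr-·   = λ {_} {x} {f} {p} → Cases.cases-ext P.carrier x λ b t z eq →
            pullʳ (a-part b eq {arr-on-part b p eq}) ∙ pullˡ (arr⊕-inj b) ∙ arr-act (P b) ∙ sym assoc
        ; ·-ident = λ x p → Cases.cases-ext P.carrier x λ b t z eq →
            a-part b eq {arr-on-part b p eq} ∙ inj P.carrier b ▹
              (act-cong (P b) {q = sym (pullˡ cod-ident ∙ identityˡ)} refl
                 (pullʳ (pullʳ (sym eq) ∙ pullˡ (arr⊕-inj b))) ∙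
               P.act-ident b z _) ∙ eq
        ; ·-comp  = λ x f g p q r s → Cases.cases-ext P.carrier x λ b t z eq →
            let eq′ = sym (a-part b eq {arr-on-part b p eq})
                r′  = pullˡ r ∙ assoc
            in a-part b eq′ {arr-on-part b q eq′} ∙ inj P.carrier b ▹
                 (P.act-comp b z (f ∘ t) (g ∘ t) _ _ r′ (arr-on-part b p eq ∙ sym cod-compose) ∙
                  act-cong (P b) refl (sym compose-natural)) ∙
               sym (a-part b eq {arr-on-part b s eq})
        }

    coproductPresheaf : Ps
    coproductPresheaf = fromAction a coproductIsAction

    injection : ∀ b → P b ⟶ coproductPresheaf
    injection b = record
      { underlying  = slicehom {h = inj P.carrier b} (arr⊕-inj b)
      ; equivariant = λ x f p q → sym (act≈· a coproductIsAction ∙ sym identityʳ ∙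
          a-part b (sym identityʳ) {p ∙ cod ▹ sym identityʳ} ∙ inj P.carrier b ▹ act-cong (P b) refl identityʳ)
      }

  -- Equivariance of a copairing concerns elements of X at an arbitrary stage T, whereas
  -- `J-coproduct` only speaks of arrows out of X. `J-ext` supplies the case distinction at every
  -- stage.
  module _ {P : Bool → Ps} {X : Ps} (J : ∀ b → P b ⟶ X)
    (J-coproduct : IsCoproduct 𝓔 (h (J true)) (h (J false)))
    (J-ext : ∀ {T Z} (z : T ⇒ Presheaf.carrier X) {u v : T ⇒ Z} →
             (∀ b {S} (t : S ⇒ T) (x : S ⇒ Presheaf.carrier (P b)) → h (J b) ∘ x ≈ z ∘ t → u ∘ t ≈ v ∘ t) →
             u ≈ v)
    where
    private
      module X = Presheaf X
      module J = IsCoproduct J-coproduct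

    module _ {Y : Ps} (H : ∀ b → P b ⟶ Y) (k : X.carrier ⇒ Presheaf.carrier Y)
             (kJ≈H : ∀ b → k ∘ h (J b) ≈ h (H b)) where
      private module Y = Presheaf Y

      abstract
        arr-copair : Y.arr ∘ k ≈ X.arr
        arr-copair = J-ext id λ b t x eq → _ ▹ sym (eq ∙ identityˡ) ∙ pullʳ (pullˡ (kJ≈H b)) ∙
          arr-at (H b) x ∙ sym (arr-at (J b) x) ∙ X.arr ▹ (eq ∙ identityˡ)

        copair-equivariant : ∀ {T} (x : T ⇒ X.carrier) (f : T ⇒ C₁) p q → k ∘ X.act x f p ≈ Y.act (k ∘ x) f q
        copair-equivariant x f p q = J-ext x λ b t y eq →
          let arr-y = sym (arr-at (J b) y) ∙ X.arr ▹ eq ∙ pullˡ p ∙ assoc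
          in pullʳ (act-natural X {q = pullˡ p ∙ assoc} ∙ sym (act-at (J b) {p = arr-y} eq)) ∙ pullˡ (kJ≈H b) ∙
             act-at (H b) {q = pullˡ q ∙ assoc} (sym (kJ≈H b) ◃ y ∙ pullʳ eq ∙ sym assoc) ∙ sym (act-natural Y)

      copair : X ⟶ Y
      copair = record { underlying = slicehom {h = k} arr-copair ; equivariant = copair-equivariant }

    reflect-coproduct : IsCoproduct PSH (J true) (J false)
    reflect-coproduct = record
      { [_,_]   = λ {Y} H K → copair {Y} (λ { true → H ; false → K }) (J.[_,_] (h H) (h K))
                                λ { true → J.inject₁ ; false → J.inject₂ }
      ; inject₁ = J.inject₁
      ; inject₂ = J.inject₂
      ; unique  = J.unique
      }

  pair : Ps → Ps → Bool → Ps
  pair P Q true  = P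
  pair P Q false = Q

  presheafCoproduct : ∀ P Q → Coproduct PSH P Q
  presheafCoproduct P Q = record
    { i₁          = injection true
    ; i₂          = injection false
    ; isCoproduct = reflect-coproduct injection (Coprod.isCoproduct _ _) part-ext
    }
    where
    open Coprods (pair P Q)
    part-ext : ∀ {T Z} (z : T ⇒ Presheaf.carrier coproductPresheaf) {u v : T ⇒ Z} →
      (∀ b {S} (t : S ⇒ T) (x : S ⇒ Presheaf.carrier (pair P Q b)) → h (injection b) ∘ x ≈ z ∘ t → u ∘ t ≈ v ∘ t) →
      u ≈ v
    part-ext z p = Cases.cases-ext (λ b → Presheaf.carrier (pair P Q b)) z p

  private module Coprodᴾ P Q = Coproduct (presheafCoproduct P Q)

  presheaf-⊕-stable : ∀ {A B X X₁ X₂} {H : X ⟶ Coprodᴾ.A+B A B}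
    {P₁ : X₁ ⟶ A} {J₁ : X₁ ⟶ X} {P₂ : X₂ ⟶ B} {J₂ : X₂ ⟶ X} →
    IsPullback PSH P₁ J₁ (Coprodᴾ.i₁ A B) H → IsPullback PSH P₂ J₂ (Coprodᴾ.i₂ A B) H →
    IsCoproduct PSH J₁ J₂
  presheaf-⊕-stable {A} {B} {X} {X₁} {X₂} {H} {P₁} {J₁} {P₂} {J₂} pb₁ pb₂ =
    reflect-coproduct J (⊕-stable pb₁′ pb₂′) J-ext
    where
    pb₁′ : IsPullback 𝓔 (h P₁) (h J₁) (Coprod.i₁ _ _) (h H)
    pb₁′ = forget-pullback pb₁

    pb₂′ : IsPullback 𝓔 (h P₂) (h J₂) (Coprod.i₂ _ _) (h H)
    pb₂′ = forget-pullback pb₂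

    J : ∀ b → pair X₁ X₂ b ⟶ X
    J true  = J₁
    J false = J₂

    carriers : Bool → Obj
    carriers b = Presheaf.carrier (pair A B b)

    J-ext : ∀ {T Z} (z : T ⇒ Presheaf.carrier X) {u v : T ⇒ Z} →
      (∀ b {S} (t : S ⇒ T) (x : S ⇒ Presheaf.carrier (pair X₁ X₂ b)) → h (J b) ∘ x ≈ z ∘ t → u ∘ t ≈ v ∘ t) →
      u ≈ v
    -- The stage is split according to the summand containing `h H ∘ z`; on each part the pullback
    -- property lifts z to X₁ or X₂.
    J-ext {T} z {u} {v} p = Cases.cases-ext carriers (h H ∘ z) {u = u} {v} on-part
      where
      on-part : ∀ b {S} (t : S ⇒ T) (x : S ⇒ carriers b) → inj carriers b ∘ x ≈ (h H ∘ z) ∘ t → u ∘ t ≈ v ∘ t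
      on-part true  t x eq = p true t (universal (eq ∙ assoc)) p₂∘universal
        where open IsPullback pb₁′
      on-part false t x eq = p false t (universal (eq ∙ assoc)) p₂∘universal
        where open IsPullback pb₂′

  reflect-⊑ : ∀ {P Q : Ps} (G : P ⟶ Q) (M : Subobject PSH Q) → h G ∈ forgetSub M →
              ∃ λ (K : P ⟶ Subobject.domain M) → h (Subobject.arrow M) ∘ h K ≈ h G
  reflect-⊑ G M (k , eq) = monoLift (Subobject.arrow M) (Subobject.isMono (forgetSub M)) G k eq , eq

  -- x ∈ X(a) belongs to ∀_F M when every restriction x · g lies in the ∀_F M
  -- computed in 𝓔: this is the largest subpresheaf of the latter.
  module Universal {X Y : Ps} (F : Y ⟶ X) (M : Subobject PSH Y) where
    private
      module X = Presheaf X

    pointwise∀ : Subobject 𝓔 X.carrier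
    pointwise∀ = ∀[ h F ] (forgetSub M)

    stable∀ : Subobject 𝓔 X.carrier
    stable∀ = ∀[ X.Actionable.p₁ ] (X.action ⁻¹[ pointwise∀ ])

    abstract
      stable∀-intro : ∀ {T} {x : T ⇒ X.carrier} →
        (∀ {S} (t : S ⇒ T) (g : S ⇒ C₁) p → X.act (x ∘ t) g p ∈ pointwise∀) → x ∈ stable∀
      stable∀-intro {x = x} p = ∀-intro X.Actionable.p₁ (X.action ⁻¹[ pointwise∀ ]) λ t y eq →
        ∈-⁻¹ X.action pointwise∀ (∈-resp pointwise∀
          (X.action ▹ sym (X.Actionable.unique eq refl))
          (p t (X.Actionable.p₂ ∘ y) (X.arr ▹ sym eq ∙ PullbackLemmas.commute-at X.Actionable.isPullback y)))

      stable∀-elim : ∀ {T} {x : T ⇒ X.carrier} → x ∈ stable∀ → ∀ (g : T ⇒ C₁) p → X.act x g p ∈ pointwise∀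
      stable∀-elim {x = x} x∈ g p = ⁻¹-∈ X.action pointwise∀
        (∀-elim X.Actionable.p₁ (X.action ⁻¹[ pointwise∀ ]) (∈-resp stable∀ (sym X.Actionable.p₁∘universal) x∈))

      -- A restriction (x · f) · g is the restriction of x along a composite, so it is already
      -- covered by the condition on x.
      stable∀-closed : Sub.ClosedUnderAction X stable∀
      stable∀-closed z f p = stable∀-intro λ t g q →
        let z∈ = ∈-∘ stable∀ t (z , refl)
            zf = pullˡ p ∙ assoc
            fg = pullˡ (sym (arr-act X)) ∙ assoc ∙ q
        in ∈-resp pointwise∀
             (sym (act-cong X {q = arr-act X ∙ fg} (act-natural X {q = zf}) refl ∙
                   X.act-comp _ (f ∘ t) g zf _ fg (zf ∙ sym cod-compose)))
             (stable∀-elim z∈ (compose (f ∘ t) g fg) (zf ∙ sym cod-compose))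

    ∀ᴾ : Subobject PSH X
    ∀ᴾ = subpresheaf X stable∀ stable∀-closed

    abstract
      -- For n in N the restriction n · g is again in N, so any y over it lies in the inverse image
      -- of N, hence in M.
      ∀ᴾ-intro : (N : Subobject PSH X) →
                 h (Subobject.arrow (FiniteLimits._⁻¹[_] presheafLimits F N)) ∈ forgetSub M →
                 h (Subobject.arrow N) ∈ stable∀
      ∀ᴾ-intro N F⁻¹N⊑M = stable∀-intro λ t g p →
        ∀-intro (h F) (forgetSub M) λ s y eq →
          ∈-resp (forgetSub M) Pb.p₁∘universal
               (∈-∘ (forgetSub M) (Pb.universal (eq ∙ sym (act-at (Subobject.arrow N) {p = arr-n p} refl) ◃ s ∙ assoc)) F⁻¹N⊑M)
        where
        module N = Subobject N
        module NP = Presheaf N.domain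
        module Pb = Pullback (pullback (h F) (h N.arrow))
        arr-n : ∀ {S} {t : S ⇒ NP.carrier} {g : S ⇒ C₁} → X.arr ∘ (h N.arrow ∘ t) ≈ cod ∘ g → NP.arr ∘ t ≈ cod ∘ g
        arr-n p = sym (arr-at N.arrow _) ∙ p

      -- Restriction along the identity recovers the condition in 𝓔 from the stable one.
      ∀ᴾ-elim : ∀ {T} {y : T ⇒ Presheaf.carrier Y} → h F ∘ y ∈ stable∀ → y ∈ forgetSub M
      ∀ᴾ-elim {y = y} Fy∈ = ∀-elim (h F) (forgetSub M)
        (∈-resp pointwise∀ (X.act-ident (h F ∘ y) (sym (pullˡ cod-ident ∙ identityˡ))) (stable∀-elim Fy∈ _ _))

    ∀ᴾ-adjoint : (N : Subobject PSH X) →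
      (_⊑_ PSH (FiniteLimits._⁻¹[_] presheafLimits F N) M) ⇔ (_⊑_ PSH N ∀ᴾ)
    ∀ᴾ-adjoint N = mk⇔
      (λ (K , eq) → reflect-⊑ (Subobject.arrow N) ∀ᴾ (∀ᴾ-intro N (h K , eq)))
      (λ (K , eq) → reflect-⊑ (Subobject.arrow F⁻¹N) M
        (∀ᴾ-elim (∈-resp stable∀ (sym (Pullback.commute (presheafPullback F (Subobject.arrow N))))
          (∈-∘ stable∀ _ (h K , eq)))))
      where F⁻¹N = FiniteLimits._⁻¹[_] presheafLimits F N

  presheafHeyting : PositiveHeyting PSH
  presheafHeyting = record
    { finiteLimits  = presheafLimits
    ; factorisation = presheafFactorisation
    ; cover-stable  = λ {P} {A} {B} {D} {p₁} {p₂} {F} {G} pb cover →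
        reflect-cover p₂ (cover-stable (forget-pullback pb) (forget-cover F cover))
    ; ⊥         = 𝟘
    ; isInitial = reflect-initial isInitial
    ; coproduct = presheafCoproduct
    ; i₁-mono   = λ {A} {B} U V → i₁-mono (h U) (h V)
    ; i₂-mono   = λ {A} {B} U V → i₂-mono (h U) (h V)
    ; disjoint  = λ pb → reflect-initial (disjoint (forget-pullback pb))
    ; ⊥-stable  = λ F → reflect-initial (⊥-stable (h F))
    ; ⊕-stable  = presheaf-⊕-stable
    ; ∀[_]      = Universal.∀ᴾ
    ; ∀-adjoint = λ F M N → Universal.∀ᴾ-adjoint F M N
    }

-- Consequences of the small map axioms in 𝓔.

module SmallMapLemmas {o ℓ e s} {𝓔 : Category o ℓ e} (𝒮 : MapClass 𝓔 s) (small : CategoryWithSmallMaps 𝓔 𝒮) where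
  open Category 𝓔
  open MapClass 𝒮
  open CategoryWithSmallMaps small
  open CategoryLemmas 𝓔
  open HeytingLemmas positiveHeyting

  -- The terminal presheaf has carrier C₀, so A4 for presheaves concerns `id`, `¡` and `fold` on C₀.
  -- Each is a pullback, along a map to `⊤`, of the corresponding map of A4 in 𝓔.
  id-small : ∀ {X} → Small (id {X})
  id-small = A1 square A4-1
    where
    square : IsPullback 𝓔 ! id ! !
    square = record
      { commute      = !-unique _ ∙ sym (!-unique _)
      ; universal    = λ {_} {_} {k} _ → k
      ; p₁∘universal = !-unique _ ∙ sym (!-unique _)
      ; p₂∘universal = identityˡ
      ; unique       = λ _ eq → sym identityˡ ∙ eq
      }

  ¡-small : ∀ {X} → Small (¡ {X})
  ¡-small = A1 square A4-0
    where
    square : IsPullback 𝓔 id ¡ ! !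
    square = record
      { commute      = !-unique _ ∙ sym (!-unique _)
      ; universal    = λ {_} {h} _ → h
      ; p₁∘universal = identityˡ
      ; p₂∘universal = λ {_} {h} → ⊥-ext h
      ; unique       = λ eq _ → sym identityˡ ∙ eq
      }

  fold : ∀ {X} → X ⊕ X ⇒ X
  fold {X} = Coprod.[_,_] X X id id

  -- The square exhibits X ⊕ X as X × (⊤ ⊕ ⊤); `tag` places x in the summand selected by z.
  fold-small : ∀ {X} → Small (fold {X})
  fold-small {X} = A1 square A4-2
    where
    Xs ⊤s : Bool → Obj
    Xs _ = X
    ⊤s _ = ⊤

    !⊕! : X ⊕ X ⇒ ⊤ ⊕ ⊤
    !⊕! = Coprod.[_,_] X X (inj ⊤s true ∘ !) (inj ⊤s false ∘ !)

    abstract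
      fold-inj : ∀ b → fold ∘ inj Xs b ≈ id
      fold-inj true  = Coprod.inject₁ X X
      fold-inj false = Coprod.inject₂ X X

      !⊕!-inj : ∀ b → !⊕! ∘ inj Xs b ≈ inj ⊤s b ∘ !
      !⊕!-inj true  = Coprod.inject₁ X X
      !⊕!-inj false = Coprod.inject₂ X X

    module _ {T} (z : T ⇒ ⊤ ⊕ ⊤) (x : T ⇒ X) where
      open Cases ⊤s z

      tag : T ⇒ X ⊕ X
      tag = case λ b → inj Xs b ∘ (x ∘ Part.p₂ b)

      abstract
        tag-inj : ∀ b {S} {t : S ⇒ T} {y : S ⇒ ⊤} → inj ⊤s b ∘ y ≈ z ∘ t → tag ∘ t ≈ inj Xs b ∘ (x ∘ t)
        tag-inj b eq = case-inj b {φ = λ b → inj Xs b ∘ (x ∘ Part.p₂ b)} eq ∙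
          pullʳ (pullʳ (Part.p₂∘universal b))

    square : IsPullback 𝓔 !⊕! fold ! !
    square = record
      { commute      = !-unique _ ∙ sym (!-unique _)
      ; universal    = λ {_} {z} {x} _ → tag z x
      ; p₁∘universal = λ {_} {z} {x} → Cases.cases-ext ⊤s z λ b t y eq →
          pullʳ (tag-inj z x b eq) ∙ pullˡ (!⊕!-inj b) ∙ pullʳ (!-unique _ ∙ sym (!-unique _)) ∙ eq
      ; p₂∘universal = λ {_} {z} {x} → Cases.cases-ext ⊤s z λ b t y eq →
          pullʳ (tag-inj z x b eq) ∙ pullˡ (fold-inj b) ∙ identityˡ
      ; unique       = λ {_} {z} {x} {_} {u} eq₁ eq₂ → Cases.cases-ext Xs u λ b t y eq →
          sym eq ∙ inj Xs b ▹ (sym identityˡ ∙ sym (fold-inj b) ◃ y ∙ pullʳ eq ∙ pullˡ eq₂) ∙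
          sym (tag-inj z x b (pullˡ (sym (!⊕!-inj b)) ∙ pullʳ eq ∙ pullˡ eq₁))
      }

  -- f is its graph Z → Z ×_B W followed by the projection to W. The graph is a pullback of the
  -- diagonal of W, small by A9, and the projection is a pullback of k.
  small-cancel : ∀ {Z W B} {f : Z ⇒ W} {q : W ⇒ B} {k : Z ⇒ B} → q ∘ f ≈ k → Small k → Small f
  small-cancel {Z} {W} {B} {f} {q} {k} qf≈k k-small =
    resp-≈ Pb.p₂∘universal (A5 (A1 Pb.isPullback k-small) (A1 square (A9 W)))
    where
    module Pb = Pullback (pullback k q)
    module W² = Product (product W W)

    graph : Z ⇒ Pb.P
    graph = Pb.universal {h = id} {k = f} (identityʳ ∙ sym qf≈k)

    square : IsPullback 𝓔 f graph (diagonal W) W².⟨ f ∘ Pb.p₁ , Pb.p₂ ⟩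
    square = record
      { commute      = W².unique (pullˡ W².project₁ ∙ identityˡ) (pullˡ W².project₂ ∙ identityˡ) ∙ sym
                         (W².unique (pullˡ W².project₁ ∙ pullʳ Pb.p₁∘universal ∙ identityʳ)
                                    (pullˡ W².project₂ ∙ Pb.p₂∘universal))
      ; universal    = λ {_} {_} {v} _ → Pb.p₁ ∘ v
      ; p₁∘universal = λ {_} {u} {v} {eq} → sym (proj-eq₁ eq)
      ; p₂∘universal = λ {_} {u} {v} {eq} → PullbackLemmas.ext Pb.isPullback
          (pullˡ Pb.p₁∘universal ∙ identityˡ)
          (pullˡ Pb.p₂∘universal ∙ sym (proj-eq₁ eq) ∙ proj-eq₂ eq)
      ; unique       = λ _ eq → sym identityˡ ∙ sym Pb.p₁∘universal ◃ _ ∙ pullʳ eq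
      }
      where
      module _ {T} {u : T ⇒ W} {v : T ⇒ Pb.P} (eq : diagonal W ∘ u ≈ W².⟨ f ∘ Pb.p₁ , Pb.p₂ ⟩ ∘ v) where
        proj-eq₁ : u ≈ f ∘ (Pb.p₁ ∘ v)
        proj-eq₁ = sym identityˡ ∙ sym W².project₁ ◃ u ∙ pullʳ eq ∙ pullˡ W².project₁ ∙ assoc

        proj-eq₂ : u ≈ Pb.p₂ ∘ v
        proj-eq₂ = sym identityˡ ∙ sym W².project₂ ◃ u ∙ pullʳ eq ∙ pullˡ W².project₂

-- Free presheaves on objects over C₀.

module FreePresheaf {o ℓ e} {𝓔 : Category o ℓ e} (lim : FiniteLimits 𝓔) (C : InternalCategory lim)
                    {B : Category.Obj 𝓔} (σ : Category._⇒_ 𝓔 B (InternalCategory.C₀ C)) where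
  open Category 𝓔
  open FiniteLimits lim
  open CategoryLemmas 𝓔
  open InternalCategory C
  open PresheafLemmas lim C
  open PresheafMap using (h)

  module Pb = Pullback (pullback σ cod)
  open PullbackLemmas Pb.isPullback

  abstract
    σ-eq : ∀ {T} (z : T ⇒ Pb.P) (f : T ⇒ C₁) (p : (dom ∘ Pb.p₂) ∘ z ≈ cod ∘ f) →
           σ ∘ (Pb.p₁ ∘ z) ≈ cod ∘ compose (Pb.p₂ ∘ z) f (sym assoc ∙ p)
    σ-eq z f p = commute-at z ∙ sym cod-compose

  -- The elements are pairs (b , k) with cod k = σ(b), and arrows act on k by precomposition: this
  -- is the sum of the representables at σ(b), indexed by B.
  freeOperation : Operation (sliceobj (dom ∘ Pb.p₂))
  freeOperation z f p = Pb.universal (σ-eq z f p)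

  abstract
    freeIsAction : IsAction (sliceobj (dom ∘ Pb.p₂)) freeOperation
    freeIsAction = record
      { cong    = λ eq₁ eq₂ → ext
          (Pb.p₁∘universal ∙ Pb.p₁ ▹ eq₁ ∙ sym Pb.p₁∘universal)
          (Pb.p₂∘universal ∙ compose-cong (Pb.p₂ ▹ eq₁) eq₂ ∙ sym Pb.p₂∘universal)
      ; natural = λ {_} {_} {x} {f} {t} {p} → ext
          (pullˡ Pb.p₁∘universal ∙ assoc ∙ sym Pb.p₁∘universal)
          (pullˡ Pb.p₂∘universal ∙ compose-natural {q = pullˡ (sym assoc ∙ p) ∙ assoc} ∙
           compose-cong assoc refl ∙ sym Pb.p₂∘universal)
      ; arr-·   = pullʳ Pb.p₂∘universal ∙ dom-compose
      ; ·-ident = λ x p → ext Pb.p₁∘universal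
          (Pb.p₂∘universal ∙ compose-cong {q = sym (pullˡ cod-ident ∙ identityˡ)} refl (ident ▹ assoc) ∙
           ident-right (Pb.p₂ ∘ x) _)
      ; ·-comp  = λ x f g p q fg r → ext
          (Pb.p₁∘universal ∙ Pb.p₁∘universal ∙ sym Pb.p₁∘universal)
          (Pb.p₂∘universal ∙ compose-cong {q = dom-compose ∙ fg} Pb.p₂∘universal refl ∙
           comp-assoc (Pb.p₂ ∘ x) f g _ fg _ (sym assoc ∙ r) ∙ sym Pb.p₂∘universal)
      }

  free : Ps
  free = fromAction freeOperation freeIsAction

  unit : B ⇒ Pb.P
  unit = Pb.universal {h = id} {k = ident ∘ σ} (identityʳ ∙ sym (pullˡ cod-ident ∙ identityˡ))

  abstract
    arr-unit : Presheaf.arr free ∘ unit ≈ σ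
    arr-unit = pullʳ Pb.p₂∘universal ∙ pullˡ dom-ident ∙ identityˡ

    -- Every element (b , k) is the restriction along k of the generator (b , id), so maps out of
    -- the free presheaf are determined on generators.
    act-unit : ∀ {p} → Presheaf.act free (unit ∘ Pb.p₁) Pb.p₂ p ≈ id
    act-unit = act≈· freeOperation freeIsAction ∙ ext
      (Pb.p₁∘universal ∙ pullˡ Pb.p₁∘universal ∙ identityˡ ∙ sym identityʳ)
      (Pb.p₂∘universal ∙
       compose-cong {q = pullˡ dom-ident ∙ identityˡ} (pullˡ Pb.p₂∘universal ∙ pullʳ Pb.commute) refl ∙
       ident-left Pb.p₂ _ ∙ sym identityʳ)

    free-ext : ∀ {W : Ps} (U V : free ⟶ W) → h U ∘ unit ≈ h V ∘ unit → h U ≈ h V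
    free-ext {W} U V eq =
      sym identityʳ ∙ h U ▹ sym (act-unit {p}) ∙ act-at U {q = arr-at V _ ∙ p} (pullˡ eq ∙ assoc) ∙
      sym (act-at V refl) ∙ h V ▹ act-unit {p} ∙ identityʳ
      where
      p : Presheaf.arr free ∘ (unit ∘ Pb.p₁) ≈ cod ∘ Pb.p₂
      p = pullˡ arr-unit ∙ Pb.commute

  module _ (W : Ps) (y : B ⇒ Presheaf.carrier W) (arr-y : Presheaf.arr W ∘ y ≈ σ) where
    private module W = Presheaf W

    abstract
      arr-yp : W.arr ∘ (y ∘ Pb.p₁) ≈ cod ∘ Pb.p₂
      arr-yp = pullˡ arr-y ∙ Pb.commute

      arr-ypz : ∀ {T} (z : T ⇒ Pb.P) → W.arr ∘ (y ∘ (Pb.p₁ ∘ z)) ≈ cod ∘ (Pb.p₂ ∘ z)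
      arr-ypz z = pullˡ arr-y ∙ commute-at z

    extension : Pb.P ⇒ W.carrier
    extension = W.act (y ∘ Pb.p₁) Pb.p₂ arr-yp

    abstract
      extension-at : ∀ {T} (z : T ⇒ Pb.P) → extension ∘ z ≈ W.act (y ∘ (Pb.p₁ ∘ z)) (Pb.p₂ ∘ z) (arr-ypz z)
      extension-at z = act-natural W {q = pullˡ arr-yp ∙ assoc} ∙ act-cong W assoc refl

      extension-· : ∀ {T} (x : T ⇒ Pb.P) (f : T ⇒ C₁) p q →
                    extension ∘ freeOperation x f p ≈ W.act (extension ∘ x) f q
      extension-· x f p q = extension-at _ ∙
        act-cong W {q = arr-ypz x ∙ sym cod-compose} (y ▹ Pb.p₁∘universal) Pb.p₂∘universal ∙
        sym (W.act-comp _ _ f (arr-ypz x) (arr-act W ∙ sym assoc ∙ p) (sym assoc ∙ p) (arr-ypz x ∙ sym cod-compose)) ∙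
        act-cong W (sym (extension-at x)) refl

    extend : free ⟶ W
    extend = mapFrom freeOperation freeIsAction W extension (arr-act W) extension-·

    abstract
      extend-unit : h extend ∘ unit ≈ y
      extend-unit = extension-at unit ∙
        act-cong W {q = sym (pullˡ cod-ident ∙ identityˡ)}
          (y ▹ Pb.p₁∘universal ∙ identityʳ) (Pb.p₂∘universal ∙ ident ▹ sym arr-y) ∙
        W.act-ident y _

-- The small map axioms for presheaves, collection foremost.

module Collections {o ℓ e s} {𝓔 : Category o ℓ e} (𝒮 : MapClass 𝓔 s) (small : CategoryWithSmallMaps 𝓔 𝒮)
  (C : InternalCategory (CategoryWithSmallMaps.finiteLimits small))
  (cod-small : MapClass.Small 𝒮 (InternalCategory.cod C)) where
  open Category 𝓔
  open CategoryWithSmallMaps small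
  open MapClass 𝒮
  open CategoryLemmas 𝓔
  open HeytingLemmas positiveHeyting
  open SmallMapLemmas 𝒮 small
  open InternalCategory C
  open PresheafLemmas finiteLimits C
  open PresheafHeyting positiveHeyting C
  open PresheafMap using (h)

  module _ {Y X A : Ps} (p : Y ⟶ X) (f : X ⟶ A) (p-cover : Cover PSH p) (f-small : Small (h f)) where
    private
      module X = Presheaf X
      module Y = Presheaf Y
      module A = Presheaf A
      module Act = A.Actionable

      -- The triples (a , k , x) with f(x) = a · k.
      module X′ = Pullback (pullback (h f) A.action)
      module Y′ = Pullback (pullback (h p) X′.p₁)

      φ : X′.P ⇒ A.carrier
      φ = Act.p₁ ∘ X′.p₂

      -- The fibre over a is a sum, over the arrows k into a, of the fibres of f over a · k; the
      -- index is small because `cod` is.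
      φ-small : Small φ
      φ-small = A5 (A1 (PullbackLemmas.pullback-sym Act.isPullback) cod-small) (A1 X′.isPullback f-small)

      open Collection (A7 Y′.p₂ φ (cover-stable Y′.isPullback (forget-cover p p-cover)) φ-small)

      module FB = FreePresheaf finiteLimits C (A.arr ∘ b)
      module FZ = FreePresheaf finiteLimits C (Y.arr ∘ (Y′.p₁ ∘ t))

      bᴾ : FB.free ⟶ A
      bᴾ = FB.extend A b refl

      tᴾ : FZ.free ⟶ Y
      tᴾ = FZ.extend Y (Y′.p₁ ∘ t) refl

      module W = Pullback (pullback (h bᴾ) (h f))

      module _ {T} (β : T ⇒ B) (w : T ⇒ X′.P) (eq : b ∘ β ≈ φ ∘ w) where
        abstract
          point-eq : (A.arr ∘ b) ∘ β ≈ cod ∘ (Act.p₂ ∘ (X′.p₂ ∘ w))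
          point-eq = assoc ∙ A.arr ▹ (eq ∙ assoc) ∙ PullbackLemmas.commute-at Act.isPullback (X′.p₂ ∘ w)

        -- Sends β and the triple (a , k , x) over b(β) = a to (β , k), which lies over a · k =
        -- f(x); x itself is then the second component of `pairPoint`.
        point : T ⇒ FB.Pb.P
        point = FB.Pb.universal point-eq

        abstract
          bᴾ-point : h bᴾ ∘ point ≈ h f ∘ (X′.p₁ ∘ w)
          bᴾ-point = FB.extension-at A b refl point ∙
            A.action ▹ sym (Act.unique (sym assoc ∙ sym eq ∙ b ▹ sym FB.Pb.p₁∘universal) (sym FB.Pb.p₂∘universal)) ∙
            sym (PullbackLemmas.commute-at X′.isPullback w)

        pairPoint : T ⇒ W.P
        pairPoint = W.universal bᴾ-point

      V = pullback b φ
      module V = Pullback V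

      -- Rearranges (β , (a , k , x)) as ((β , k) , x). The inverse `split` puts a = b(β) back;
      -- being a section is all that the cover argument asks of it.
      compare : V.P ⇒ W.P
      compare = pairPoint V.p₁ V.p₂ V.commute

      abstract
        split-eq : b ∘ (FB.Pb.p₁ ∘ W.p₁) ≈ φ ∘ X′.universal
          {h = W.p₂} {k = Act.universal (FB.arr-ypz A b refl W.p₁)}
          (sym W.commute ∙ FB.extension-at A b refl W.p₁)
        split-eq = sym Act.p₁∘universal ∙ Act.p₁ ▹ sym X′.p₂∘universal ∙ sym assoc

      split : W.P ⇒ V.P
      split = V.universal split-eq

      w : Z ⇒ X′.P
      w = Y′.p₂ ∘ t

      zPoint : Z ⇒ FB.Pb.P
      zPoint = point g w commute

      abstract
        compare-split : compare ∘ split ≈ id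
        compare-split = PullbackLemmas.ext W.isPullback
          (PullbackLemmas.ext FB.Pb.isPullback
            (FB.Pb.p₁ ▹ pullˡ W.p₁∘universal ∙ pullˡ FB.Pb.p₁∘universal ∙ V.p₁∘universal ∙ FB.Pb.p₁ ▹ sym identityʳ)
            (FB.Pb.p₂ ▹ pullˡ W.p₁∘universal ∙ pullˡ FB.Pb.p₂∘universal ∙
             pullʳ (pullʳ V.p₂∘universal ∙ X′.p₂∘universal) ∙ Act.p₂∘universal ∙ FB.Pb.p₂ ▹ sym identityʳ))
          (pullˡ W.p₂∘universal ∙ pullʳ V.p₂∘universal ∙ X′.p₁∘universal ∙ sym identityʳ)

        compare-Z : compare ∘ V.universal commute ≈ pairPoint g w commute
        compare-Z = W.unique
          (PullbackLemmas.ext FB.Pb.isPullback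
            (FB.Pb.p₁ ▹ pullˡ W.p₁∘universal ∙ pullˡ FB.Pb.p₁∘universal ∙ V.p₁∘universal ∙ sym FB.Pb.p₁∘universal)
            (FB.Pb.p₂ ▹ pullˡ W.p₁∘universal ∙ pullˡ FB.Pb.p₂∘universal ∙
             pullʳ (pullʳ V.p₂∘universal) ∙ sym FB.Pb.p₂∘universal))
          (pullˡ W.p₂∘universal ∙ pullʳ V.p₂∘universal)

        x-eq : X′.p₁ ∘ w ≈ h p ∘ (Y′.p₁ ∘ t)
        x-eq = sym (PullbackLemmas.commute-at Y′.isPullback t)

        arr-zPoint : Presheaf.arr FB.free ∘ zPoint ≈ Y.arr ∘ (Y′.p₁ ∘ t)
        arr-zPoint = pullʳ FB.Pb.p₂∘universal ∙ pullˡ (sym A.arr-action) ∙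
          pullʳ (sym (PullbackLemmas.commute-at X′.isPullback w)) ∙ arr-at f _ ∙ X.arr ▹ x-eq ∙ arr-at p _

      gᴾ : FZ.free ⟶ FB.free
      gᴾ = FZ.extend FB.free zPoint arr-zPoint

      abstract
        square : h bᴾ ∘ h gᴾ ≈ h f ∘ (h p ∘ h tᴾ)
        square = FZ.free-ext (Category._∘_ PSH bᴾ gᴾ) (Category._∘_ PSH f (Category._∘_ PSH p tᴾ))
          (pullʳ (FZ.extend-unit FB.free zPoint arr-zPoint) ∙ bᴾ-point g w commute ∙ h f ▹ x-eq ∙
           sym (pullʳ (pullʳ (FZ.extend-unit Y (Y′.p₁ ∘ t) refl))))

        -- Followed by the projection to B, `gᴾ` becomes the projection to Z, a pullback of `cod`,
        -- followed by g. That composite is small, and the projection to B cancels.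
        gᴾ-small : Small (h gᴾ)
        gᴾ-small = small-cancel
          (FB.Pb.p₁ ▹ act≈· FB.freeOperation FB.freeIsAction ∙ FB.Pb.p₁∘universal ∙ pullˡ FB.Pb.p₁∘universal)
          (A5 g-small (A1 (PullbackLemmas.pullback-sym FZ.Pb.isPullback) cod-small))

        -- Restricted to the generators Z, the comparison map is the cover Z → B ×_A X′ supplied by
        -- collection followed by the split `compare`. A map is a cover as soon as it becomes one
        -- after precomposition.
        universal-cover : Cover 𝓔 (W.universal square)
        universal-cover = cover-cancel universal-unit (split∘cover compare-Z compare-split Z-cover)
          where
          universal-unit : W.universal square ∘ FZ.unit ≈ pairPoint g w commute
          universal-unit = W.unique
            (pullˡ W.p₁∘universal ∙ FZ.extend-unit FB.free zPoint arr-zPoint)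
            (pullˡ W.p₂∘universal ∙ pullʳ (FZ.extend-unit Y (Y′.p₁ ∘ t) refl) ∙ sym x-eq)

    presheafCollection : Collection PSH (PointwiseSmall finiteLimits C 𝒮) presheafLimits p f
    presheafCollection = record
      { g       = gᴾ
      ; t       = tᴾ
      ; b       = bᴾ
      ; g-small = gᴾ-small
      -- On generators `bᴾ` is already the cover b.
      ; b-cover = reflect-cover bᴾ (cover-cancel (FB.extend-unit A b refl) b-cover)
      ; commute = square
      ; Z-cover = reflect-cover (Pullback.universal (presheafPullback bᴾ f)
                    {h = gᴾ} {k = Category._∘_ PSH p tᴾ} square) universal-cover
      }

  presheafAxioms : SmallMapAxioms PSH (PointwiseSmall finiteLimits C 𝒮) presheafHeyting
  presheafAxioms = record
    { A1   = λ pb → A1 (forget-pullback pb)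
    ; A2   = λ {_} {_} {_} {_} {_} {_} {_} {G} pb G-cover → A2 (forget-pullback pb) (forget-cover G G-cover)
    ; A3   = A3
    ; A4-0 = ¡-small
    ; A4-1 = id-small
    ; A4-2 = fold-small
    ; A5   = A5
    ; A6   = λ {_} {_} {_} {F} GF-small F-cover → A6 GF-small (forget-cover F F-cover)
    ; A7   = presheafCollection
    -- A8 of 𝓔 is used twice, matching the two quantifiers in `stable∀`: along `h F`, then along the
    -- projection from actionable pairs, a pullback of `cod`. Between them the subobject is pulled
    -- back along the action.
    ; A8   = λ {X} F F-small M M-small →
        A8 (Presheaf.Actionable.p₁ X) (A1 (PullbackLemmas.pullback-sym (Presheaf.Actionable.isPullback X)) cod-small) _
          (A1 (PullbackLemmas.pullback-sym (Pullback.isPullback (pullback (Presheaf.action X) _)))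
            (A8 (h F) F-small (forgetSub M) M-small))
    -- The product of presheaves is taken over C₀; its diagonal has the first projection as
    -- retraction, so it cancels from the identity.
    ; A9   = λ X → small-cancel (Pullback.p₁∘universal (pullback (Presheaf.arr X) (Presheaf.arr X))) id-small
    }

theorem3p1 : ∀ {o ℓ e s} (𝓔 : Category o ℓ e) (𝒮 : MapClass 𝓔 s)
    (pred : PredicativeCategoryWithSmallMaps 𝓔 𝒮) →
    let open PredicativeCategoryWithSmallMaps pred using (finiteLimits) in
    (C : InternalCategory finiteLimits) →
    MapClass.Small 𝒮 (InternalCategory.cod C) →
    CategoryWithSmallMaps (Psh finiteLimits C) (PointwiseSmall finiteLimits C 𝒮)
theorem3p1 𝓔 𝒮 pred C cod-small = record
  { positiveHeyting = PresheafHeyting.presheafHeyting positiveHeyting C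
  ; smallMapAxioms  = Collections.presheafAxioms 𝒮 categoryWithSmallMaps C cod-small
  }
  where open PredicativeCategoryWithSmallMaps pred using (categoryWithSmallMaps; positiveHeyting)
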